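{- Let $K$ be a quadratic field with embeddings into $\mathbb{R}$ and $\mathbb{Q}_2$, and let $\alpha\in K\setminus\mathbb{Q}$ have property $I$. Let $\{\alpha_{(n)}\}_{n\ge1}$ be the sequence generated by the algorithm described in the context. Then there exist positive integers $n_1<n_2$ such that $\alpha_{(n_1)}=\alpha_{(n_2)}$ and $n_1\equiv n_2\pmod 2$.
   Context: $K$ is a quadratic field with fixed field embeddings $\sigma_\infty:K\to\mathbb{R}$ and $\sigma_2:K\to\mathbb{Q}_2$. For $\alpha\in K$ write $\alpha_\infty=\sigma_\infty(\alpha)$, $\alpha_{\langle 2\rangle}=\sigma_2(\alpha)$. For $u=\sum_{n}c_n2^n\in\mathbb{Q}_2$ with digits $c_n\in\{0,1\}$ ($c_n=0$ for $n<v_2(u)$), put $\lfloor u\rfloor_2=\sum_{n\le 0}c_n2^n\in\mathbb{Z}[1/2]$. Property $I$: $\alpha_\infty\in(-1,1]$ and $v_2(\alpha_{\langle 2\rangle})>0$. For $\alpha\in K^\times$ let $a^{(0)}(\alpha)=2m+\lfloor(1/\alpha)_{\langle 2\rangle}\rfloor_2$, where $m$ is the smallest among the integers $i$ minimizing $|(1/\alpha)_\infty-2i-\lfloor(1/\alpha)_{\langle 2\rangle}\rfloor_2|$; let $a^{(1)}(\alpha)=m'+\lfloor(1/\alpha)_{\langle 2\rangle}\rfloor_2$, where $m'$ is the smallest among the integers $i$ minimizing $|(1/\alpha)_\infty-i-\lfloor(1/\alpha)_{\langle 2\rangle}\rfloor_2|$. Put $T_{2,\epsilon}(\alpha)=\frac1\alpha-a^{(\epsilon)}(\alpha)$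 for $\epsilon\in\{0,1\}$. Algorithm: $\alpha_{(1)}=\alpha$; for $n\ge1$, $\alpha_{(n+1)}=T_{2,0}(\alpha_{(n)})$ if $n$ is even and $\alpha_{(n+1)}=T_{2,1}(\alpha_{(n)})$ if $n$ is odd (for $\alpha\in K\setminus\mathbb{Q}$ the algorithm never terminates). -}

module Defs where

open import Level using (Level; _⊔_; suc; 0ℓ)
open import Algebra.Bundles using (CommutativeRing)
open import Algebra.Bundles.Raw using (RawRing)
open import Algebra.Morphism.Structures using (IsRingHomomorphism; IsRingMonomorphism)
open import Data.Nat.Base as ℕ using (ℕ)
import Data.Nat.DivMod as ℕ
import Data.Nat.Divisibility as ℕ
import Data.Nat.Properties as ℕ
open import Data.Integer.Base as ℤ using (ℤ; +_; -[1+_])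
import Data.Integer.DivMod as ℤ
import Data.Integer.Properties as ℤ
open import Data.Integer.Divisibility.Signed as ℤ using () renaming (_∣_ to _∣ℤ_)
open import Data.Integer.Solver renaming (module +-*-Solver to ℤ-Solver)
open import Data.Rational.Base as ℚ using (ℚ; 0ℚ; 1ℚ; ½)
import Data.Rational.Properties as ℚ
open import Data.Rational.Solver renaming (module +-*-Solver to ℚ-Solver)
open import Data.Fin.Base using (Fin)
open import Data.Fin.Patterns using (0F; 1F)
open import Data.Product.Base using (∃₂; ∃-syntax; _×_; _,_)
open import Data.Sum.Base using (inj₁; inj₂)
open import Relation.Nullary.Negation using (¬_)
open import Relation.Binary.PropositionalEquality
  using (_≡_; refl; sym; trans; cong; subst; subst₂)

-- Real numbers: Cauchy sequences of rationals, compared up to null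
-- sequences.

record ℝ : Set where
  constructor mkℝ
  field
    seq    : ℕ → ℚ
    cauchy : ∀ ε → 0ℚ ℚ.< ε →
             ∃[ N ] (∀ m n → N ℕ.≤ m → N ℕ.≤ n → ℚ.∣ seq m ℚ.- seq n ∣ ℚ.< ε)

open ℝ public

infix  4 _≈ʳ_ _<ʳ_ _≤ʳ_
infixl 6 _+ʳ_ _-ʳ_
infixl 7 _*ʳ_
infix  8 -ʳ_

_≈ʳ_ : ℝ → ℝ → Set
x ≈ʳ y = ∀ ε → 0ℚ ℚ.< ε →
         ∃[ N ] (∀ n → N ℕ.≤ n → ℚ.∣ seq x n ℚ.- seq y n ∣ ℚ.< ε)

_<ʳ_ : ℝ → ℝ → Set
x <ʳ y = ∃[ ε ] (0ℚ ℚ.< ε × ∃[ N ] (∀ n → N ℕ.≤ n → seq x n ℚ.+ ε ℚ.< seq y n))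

_≤ʳ_ : ℝ → ℝ → Set
x ≤ʳ y = ¬ (y <ʳ x)

private
  triangle : ∀ p q {r s} → ℚ.∣ p ∣ ℚ.< r → ℚ.∣ q ∣ ℚ.< s → ℚ.∣ p ℚ.+ q ∣ ℚ.< r ℚ.+ s
  triangle p q h k = ℚ.≤-<-trans (ℚ.∣p+q∣≤∣p∣+∣q∣ p q) (ℚ.+-mono-< h k)

  half>0 : ∀ {ε} → 0ℚ ℚ.< ε → 0ℚ ℚ.< ½ ℚ.* ε
  half>0 {ε} h = subst (ℚ._< ½ ℚ.* ε) (ℚ.*-zeroʳ ½) (ℚ.*-monoʳ-<-pos ½ h)

  half+half : ∀ ε → ½ ℚ.* ε ℚ.+ ½ ℚ.* ε ≡ ε
  half+half ε = trans (sym (ℚ.*-distribʳ-+ ε ½ ½)) (ℚ.*-identityˡ ε)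

  ∣p∣-∣q∣≤∣p-q∣ : ∀ p q → ℚ.∣ p ∣ ℚ.- ℚ.∣ q ∣ ℚ.≤ ℚ.∣ p ℚ.- q ∣
  ∣p∣-∣q∣≤∣p-q∣ p q =
    subst (ℚ.∣ p ∣ ℚ.- ℚ.∣ q ∣ ℚ.≤_) (lem′ ℚ.∣ p ℚ.- q ∣ ℚ.∣ q ∣)
      (ℚ.+-monoˡ-≤ (ℚ.- ℚ.∣ q ∣)
        (subst (λ t → ℚ.∣ t ∣ ℚ.≤ ℚ.∣ p ℚ.- q ∣ ℚ.+ ℚ.∣ q ∣) (lem p q)
          (ℚ.∣p+q∣≤∣p∣+∣q∣ (p ℚ.- q) q)))
    where
    open ℚ-Solver
    lem : ∀ p q → p ℚ.- q ℚ.+ q ≡ p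
    lem = solve 2 (λ p q → p :- q :+ q := p) refl
    lem′ : ∀ a b → a ℚ.+ b ℚ.- b ≡ a
    lem′ = solve 2 (λ a b → a :+ b :- b := a) refl

  ∣-∣-swap : ∀ p q → ℚ.∣ p ℚ.- q ∣ ≡ ℚ.∣ q ℚ.- p ∣
  ∣-∣-swap p q = trans (sym (ℚ.∣-p∣≡∣p∣ (p ℚ.- q))) (cong ℚ.∣_∣ (lem p q))
    where
    open ℚ-Solver
    lem : ∀ p q → ℚ.- (p ℚ.- q) ≡ q ℚ.- p
    lem = solve 2 (λ p q → :- (p :- q) := q :- p) refl

  ∣∣p∣-∣q∣∣≤∣p-q∣ : ∀ p q → ℚ.∣ ℚ.∣ p ∣ ℚ.- ℚ.∣ q ∣ ∣ ℚ.≤ ℚ.∣ p ℚ.- q ∣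
  ∣∣p∣-∣q∣∣≤∣p-q∣ p q with ℚ.∣p∣≡p∨∣p∣≡-p (ℚ.∣ p ∣ ℚ.- ℚ.∣ q ∣)
  ... | inj₁ e = subst (ℚ._≤ ℚ.∣ p ℚ.- q ∣) (sym e) (∣p∣-∣q∣≤∣p-q∣ p q)
  ... | inj₂ e = subst₂ ℚ._≤_ (sym (trans e (lem ℚ.∣ p ∣ ℚ.∣ q ∣))) (∣-∣-swap q p)
                       (∣p∣-∣q∣≤∣p-q∣ q p)
    where
    open ℚ-Solver
    lem : ∀ p q → ℚ.- (p ℚ.- q) ≡ q ℚ.- p
    lem = solve 2 (λ p q → :- (p :- q) := q :- p) refl

  eventually-bounded : ∀ x → ∃[ B ] (0ℚ ℚ.< B × ∃[ N ] (∀ n → N ℕ.≤ n → ℚ.∣ seq x n ∣ ℚ.< B))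
  eventually-bounded x with cauchy x 1ℚ (ℚ.positive⁻¹ 1ℚ)
  ... | N , h = 1ℚ ℚ.+ (ℚ.∣ seq x N ∣ ℚ.+ 1ℚ) , B>0 , N , bound
    where
    open ℚ-Solver
    0<c : 0ℚ ℚ.< ℚ.∣ seq x N ∣ ℚ.+ 1ℚ
    0<c = ℚ.+-mono-≤-< (ℚ.0≤∣p∣ (seq x N)) (ℚ.positive⁻¹ 1ℚ)
    B>0 : 0ℚ ℚ.< 1ℚ ℚ.+ (ℚ.∣ seq x N ∣ ℚ.+ 1ℚ)
    B>0 = ℚ.+-mono-< (ℚ.positive⁻¹ 1ℚ) 0<c
    lt : ℚ.∣ seq x N ∣ ℚ.< ℚ.∣ seq x N ∣ ℚ.+ 1ℚ
    lt = subst (ℚ._< ℚ.∣ seq x N ∣ ℚ.+ 1ℚ) (ℚ.+-identityʳ ℚ.∣ seq x N ∣)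
           (ℚ.+-monoʳ-< ℚ.∣ seq x N ∣ (ℚ.positive⁻¹ 1ℚ))
    lem : ∀ p q → p ℚ.- q ℚ.+ q ≡ p
    lem = solve 2 (λ p q → p :- q :+ q := p) refl
    bound : ∀ n → N ℕ.≤ n → ℚ.∣ seq x n ∣ ℚ.< 1ℚ ℚ.+ (ℚ.∣ seq x N ∣ ℚ.+ 1ℚ)
    bound n N≤n = subst (λ t → ℚ.∣ t ∣ ℚ.< 1ℚ ℚ.+ (ℚ.∣ seq x N ∣ ℚ.+ 1ℚ)) (lem (seq x n) (seq x N))
                    (triangle (seq x n ℚ.- seq x N) (seq x N) (h n N N≤n ℕ.≤-refl) lt)

  -- ∣ab∣ < ε once ∣a∣ < B and ∣b∣ < ε/B
  quotient : ∀ {B ε} → 0ℚ ℚ.< B → 0ℚ ℚ.< ε →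
             ∃[ δ ] (0ℚ ℚ.< δ × (∀ a b → ℚ.∣ a ∣ ℚ.< B → ℚ.∣ b ∣ ℚ.< δ → ℚ.∣ a ℚ.* b ∣ ℚ.< ε))
  quotient {B} {ε} B>0 ε>0 = δ , δ>0 , bound
    where
    instance
      B+ : ℚ.Positive B
      B+ = ℚ.positive B>0
      B≠0 : ℚ.NonZero B
      B≠0 = ℚ.pos⇒nonZero B
      B⁻¹+ : ℚ.Positive (ℚ.1/ B)
      B⁻¹+ = ℚ.1/pos⇒pos B
    δ : ℚ
    δ = ℚ.1/ B ℚ.* ε
    δ>0 : 0ℚ ℚ.< δ
    δ>0 = subst (ℚ._< δ) (ℚ.*-zeroʳ (ℚ.1/ B)) (ℚ.*-monoʳ-<-pos (ℚ.1/ B) ε>0)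
    Bδ≡ε : B ℚ.* δ ≡ ε
    Bδ≡ε = trans (sym (ℚ.*-assoc B (ℚ.1/ B) ε))
             (trans (cong (ℚ._* ε) (ℚ.*-inverseʳ B)) (ℚ.*-identityˡ ε))
    bound : ∀ a b → ℚ.∣ a ∣ ℚ.< B → ℚ.∣ b ∣ ℚ.< δ → ℚ.∣ a ℚ.* b ∣ ℚ.< ε
    bound a b ha hb = subst₂ ℚ._<_ (sym (ℚ.∣p*q∣≡∣p∣*∣q∣ a b)) Bδ≡ε
      (ℚ.≤-<-trans
        (ℚ.*-monoʳ-≤-nonNeg ℚ.∣ b ∣ {{ℚ.∣-∣-nonNeg b}} (ℚ.<⇒≤ ha))
        (ℚ.*-monoʳ-<-pos B hb))

fromℚ : ℚ → ℝ
fromℚ q = mkℝ (λ _ → q) λ ε ε>0 → 0 , λ _ _ _ _ →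
  subst (ℚ._< ε) (sym (cong ℚ.∣_∣ (ℚ.+-inverseʳ q))) ε>0

_+ʳ_ : ℝ → ℝ → ℝ
x +ʳ y = mkℝ (λ n → seq x n ℚ.+ seq y n) c
  where
  open ℚ-Solver
  lem : ∀ a b c d → (a ℚ.- b) ℚ.+ (c ℚ.- d) ≡ (a ℚ.+ c) ℚ.- (b ℚ.+ d)
  lem = solve 4 (λ a b c d → (a :- b) :+ (c :- d) := (a :+ c) :- (b :+ d)) refl
  c : ∀ ε → 0ℚ ℚ.< ε → ∃[ N ] (∀ m n → N ℕ.≤ m → N ℕ.≤ n →
      ℚ.∣ (seq x m ℚ.+ seq y m) ℚ.- (seq x n ℚ.+ seq y n) ∣ ℚ.< ε)
  c ε ε>0 with cauchy x (½ ℚ.* ε) (half>0 ε>0) | cauchy y (½ ℚ.* ε) (half>0 ε>0)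
  ... | M , h | N , k = M ℕ.⊔ N , λ m n p q →
    subst₂ (λ s t → ℚ.∣ s ∣ ℚ.< t)
      (lem (seq x m) (seq x n) (seq y m) (seq y n)) (half+half ε)
      (triangle (seq x m ℚ.- seq x n) (seq y m ℚ.- seq y n)
        (h m n (ℕ.m⊔n≤o⇒m≤o M N p) (ℕ.m⊔n≤o⇒m≤o M N q))
        (k m n (ℕ.m⊔n≤o⇒n≤o M N p) (ℕ.m⊔n≤o⇒n≤o M N q)))

-ʳ_ : ℝ → ℝ
-ʳ x = mkℝ (λ n → ℚ.- seq x n) c
  where
  open ℚ-Solver
  lem : ∀ a b → b ℚ.- a ≡ (ℚ.- a) ℚ.- (ℚ.- b)
  lem = solve 2 (λ a b → b :- a := (:- a) :- (:- b)) refl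
  c : ∀ ε → 0ℚ ℚ.< ε → ∃[ N ] (∀ m n → N ℕ.≤ m → N ℕ.≤ n →
      ℚ.∣ (ℚ.- seq x m) ℚ.- (ℚ.- seq x n) ∣ ℚ.< ε)
  c ε ε>0 with cauchy x ε ε>0
  ... | N , h = N , λ m n p q →
    subst (λ s → ℚ.∣ s ∣ ℚ.< ε) (lem (seq x m) (seq x n)) (h n m q p)

_-ʳ_ : ℝ → ℝ → ℝ
x -ʳ y = x +ʳ (-ʳ y)

_*ʳ_ : ℝ → ℝ → ℝ
x *ʳ y = mkℝ (λ n → seq x n ℚ.* seq y n) c
  where
  open ℚ-Solver
  lem : ∀ a b c d → a ℚ.* (c ℚ.- d) ℚ.+ d ℚ.* (a ℚ.- b) ≡ a ℚ.* c ℚ.- b ℚ.* d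
  lem = solve 4 (λ a b c d → a :* (c :- d) :+ d :* (a :- b) := a :* c :- b :* d) refl
  close : ∀ ε a b c d → ℚ.∣ a ℚ.* (c ℚ.- d) ∣ ℚ.< ½ ℚ.* ε → ℚ.∣ d ℚ.* (a ℚ.- b) ∣ ℚ.< ½ ℚ.* ε →
          ℚ.∣ a ℚ.* c ℚ.- b ℚ.* d ∣ ℚ.< ε
  close ε a b c d h k = subst₂ (λ s t → ℚ.∣ s ∣ ℚ.< t) (lem a b c d) (half+half ε)
    (triangle (a ℚ.* (c ℚ.- d)) (d ℚ.* (a ℚ.- b)) h k)
  c : ∀ ε → 0ℚ ℚ.< ε → ∃[ N ] (∀ m n → N ℕ.≤ m → N ℕ.≤ n →
      ℚ.∣ seq x m ℚ.* seq y m ℚ.- seq x n ℚ.* seq y n ∣ ℚ.< ε)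
  c ε ε>0 =
    let A , A>0 , N₁ , hA = eventually-bounded x
        B , B>0 , N₂ , hB = eventually-bounded y
        δ , δ>0 , hδ = quotient A>0 (half>0 ε>0)
        η , η>0 , hη = quotient B>0 (half>0 ε>0)
        N₃ , hy = cauchy y δ δ>0
        N₄ , hx = cauchy x η η>0
    in (N₁ ℕ.⊔ N₂) ℕ.⊔ (N₃ ℕ.⊔ N₄) , λ m n p q →
      let p₁₂ = ℕ.m⊔n≤o⇒m≤o (N₁ ℕ.⊔ N₂) (N₃ ℕ.⊔ N₄) p
          p₃₄ = ℕ.m⊔n≤o⇒n≤o (N₁ ℕ.⊔ N₂) (N₃ ℕ.⊔ N₄) p
          q₁₂ = ℕ.m⊔n≤o⇒m≤o (N₁ ℕ.⊔ N₂) (N₃ ℕ.⊔ N₄) q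
          q₃₄ = ℕ.m⊔n≤o⇒n≤o (N₁ ℕ.⊔ N₂) (N₃ ℕ.⊔ N₄) q
      in close ε (seq x m) (seq x n) (seq y m) (seq y n)
        (hδ (seq x m) (seq y m ℚ.- seq y n) (hA m (ℕ.m⊔n≤o⇒m≤o N₁ N₂ p₁₂))
          (hy m n (ℕ.m⊔n≤o⇒m≤o N₃ N₄ p₃₄) (ℕ.m⊔n≤o⇒m≤o N₃ N₄ q₃₄)))
        (hη (seq y n) (seq x m ℚ.- seq x n) (hB n (ℕ.m⊔n≤o⇒n≤o N₁ N₂ q₁₂))
          (hx m n (ℕ.m⊔n≤o⇒n≤o N₃ N₄ p₃₄) (ℕ.m⊔n≤o⇒n≤o N₃ N₄ q₃₄)))

∣_∣ʳ : ℝ → ℝ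
∣ x ∣ʳ = mkℝ (λ n → ℚ.∣ seq x n ∣) λ ε ε>0 → let N , h = cauchy x ε ε>0 in
  N , λ m n p q → ℚ.≤-<-trans (∣∣p∣-∣q∣∣≤∣p-q∣ (seq x m) (seq x n)) (h m n p q)

ℝ-rawRing : RawRing 0ℓ 0ℓ
ℝ-rawRing = record
  { Carrier = ℝ
  ; _≈_     = _≈ʳ_
  ; _+_     = _+ʳ_
  ; _*_     = _*ʳ_
  ; -_      = -ʳ_
  ; 0#      = fromℚ 0ℚ
  ; 1#      = fromℚ 1ℚ
  }

-- 2-adic integers: the inverse limit of the rings ℤ/2ⁿ, the class in
-- ℤ/2ⁿ being represented by the integer  app a n .

2^ : ℕ → ℤ
2^ n = + (2 ℕ.^ n)

record ℤ₂ : Set where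
  constructor mkℤ₂
  field
    app      : ℕ → ℤ
    coherent : ∀ n → 2^ n ∣ℤ app (ℕ.suc n) ℤ.- app n

open ℤ₂ public

_≈ᶻ_ : ℤ₂ → ℤ₂ → Set
a ≈ᶻ b = ∀ n → 2^ n ∣ℤ app a n ℤ.- app b n

infix  4 _≈ᶻ_
infixl 6 _+ᶻ_
infixl 7 _*ᶻ_
infix  8 -ᶻ_

fromℤ : ℤ → ℤ₂
fromℤ i = mkℤ₂ (λ _ → i) λ n → subst (2^ n ∣ℤ_) (sym (ℤ.+-inverseʳ i)) (ℤ.divides (+ 0) refl)

_+ᶻ_ : ℤ₂ → ℤ₂ → ℤ₂
a +ᶻ b = mkℤ₂ (λ n → app a n ℤ.+ app b n) λ n →
  subst (2^ n ∣ℤ_) (lem (app a (ℕ.suc n)) (app a n) (app b (ℕ.suc n)) (app b n))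
    (ℤ.∣m∣n⇒∣m+n (coherent a n) (coherent b n))
  where
  open ℤ-Solver
  lem : ∀ a b c d → (a ℤ.- b) ℤ.+ (c ℤ.- d) ≡ (a ℤ.+ c) ℤ.- (b ℤ.+ d)
  lem = solve 4 (λ a b c d → (a :- b) :+ (c :- d) := (a :+ c) :- (b :+ d)) refl

-ᶻ_ : ℤ₂ → ℤ₂
-ᶻ a = mkℤ₂ (λ n → ℤ.- app a n) λ n →
  subst (2^ n ∣ℤ_) (lem (app a (ℕ.suc n)) (app a n)) (ℤ.∣m⇒∣-m (coherent a n))
  where
  open ℤ-Solver
  lem : ∀ a b → ℤ.- (a ℤ.- b) ≡ (ℤ.- a) ℤ.- (ℤ.- b)
  lem = solve 2 (λ a b → :- (a :- b) := (:- a) :- (:- b)) refl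

_*ᶻ_ : ℤ₂ → ℤ₂ → ℤ₂
a *ᶻ b = mkℤ₂ (λ n → app a n ℤ.* app b n) λ n →
  subst (2^ n ∣ℤ_) (lem (app a (ℕ.suc n)) (app a n) (app b (ℕ.suc n)) (app b n))
    (ℤ.∣m∣n⇒∣m+n (ℤ.∣n⇒∣m*n (app a (ℕ.suc n)) (coherent b n))
                  (ℤ.∣n⇒∣m*n (app b n) (coherent a n)))
  where
  open ℤ-Solver
  lem : ∀ a b c d → a ℤ.* (c ℤ.- d) ℤ.+ d ℤ.* (a ℤ.- b) ≡ a ℤ.* c ℤ.- b ℤ.* d
  lem = solve 4 (λ a b c d → a :* (c :- d) :+ d :* (a :- b) := a :* c :- b :* d) refl

-- The coefficient cₙ ∈ {0,1} in a = Σₙ cₙ 2ⁿ, read off from the residue of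
-- a modulo 2ⁿ⁺¹.
digitᶻ : ℤ₂ → ℕ → ℕ
digitᶻ a n = (app a (ℕ.suc n) ℤ.%ℕ (2 ℕ.^ ℕ.suc n)) ℕ./ (2 ℕ.^ n)
  where
  instance
    _ = ℕ.m^n≢0 2 (ℕ.suc n)
    _ = ℕ.m^n≢0 2 n

-- 2-adic numbers: ℚ₂ = ℤ₂[1/2], where  a /2^ k  stands for a / 2ᵏ.

record ℚ₂ : Set where
  constructor _/2^_
  field
    num : ℤ₂
    exp : ℕ

open ℚ₂ public

infix  4 _≈₂_
infixl 6 _+₂_
infixl 7 _*₂_
infix  8 -₂_

_≈₂_ : ℚ₂ → ℚ₂ → Set
(a /2^ k) ≈₂ (b /2^ l) = fromℤ (2^ l) *ᶻ a ≈ᶻ fromℤ (2^ k) *ᶻ b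

_+₂_ : ℚ₂ → ℚ₂ → ℚ₂
(a /2^ k) +₂ (b /2^ l) = (fromℤ (2^ l) *ᶻ a +ᶻ fromℤ (2^ k) *ᶻ b) /2^ (k ℕ.+ l)

-₂_ : ℚ₂ → ℚ₂
-₂ (a /2^ k) = (-ᶻ a) /2^ k

_*₂_ : ℚ₂ → ℚ₂ → ℚ₂
(a /2^ k) *₂ (b /2^ l) = (a *ᶻ b) /2^ (k ℕ.+ l)

ℚ₂-rawRing : RawRing 0ℓ 0ℓ
ℚ₂-rawRing = record
  { Carrier = ℚ₂
  ; _≈_     = _≈₂_
  ; _+_     = _+₂_
  ; _*_     = _*₂_
  ; -_      = -₂_
  ; 0#      = fromℤ (+ 0) /2^ 0
  ; 1#      = fromℤ (+ 1) /2^ 0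
  }

-- The coefficient cₙ, n ∈ ℤ, in u = Σₙ cₙ 2ⁿ.
digit : ℚ₂ → ℤ → ℕ
digit (a /2^ k) n with n ℤ.+ + k
... | + m      = digitᶻ a m
... | -[1+ _ ] = 0

HasValuation : ℚ₂ → ℤ → Set
HasValuation u v = digit u v ≡ 1 × (∀ n → n ℤ.< v → digit u n ≡ 0)

-- v₂(u) > 0, with the convention v₂(0) = ∞ : zero has no valuation in the
-- sense of HasValuation.
PositiveValuation : ℚ₂ → Set
PositiveValuation u = ∀ v → HasValuation u v → + 0 ℤ.< v

Σ≤ : ℕ → (ℕ → ℚ) → ℚ
Σ≤ ℕ.zero    f = f 0
Σ≤ (ℕ.suc k) f = Σ≤ k f ℚ.+ f (ℕ.suc k)

-- ⌊u⌋₂ = Σ_{n ≤ 0} cₙ 2ⁿ, with n = - j; the digits with j > exp u vanish.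
⌊_⌋₂ : ℚ₂ → ℚ
⌊ u ⌋₂ = Σ≤ (exp u) λ j → ℚ._/_ (+ digit u (ℤ.- + j)) (2 ℕ.^ j) {{ℕ.m^n≢0 2 j}}

record QuadraticField (c ℓ : Level) : Set (suc (c ⊔ ℓ)) where
  field
    commutativeRing : CommutativeRing c ℓ

  open CommutativeRing commutativeRing public

  field
    1≉0     : ¬ (1# ≈ 0#)
    inverse : ∀ x → ¬ (x ≈ 0#) → ∃[ y ] (x * y ≈ 1#)
    ι       : ℚ → Carrier
    ι-isRingHomomorphism : IsRingHomomorphism ℚ.+-*-rawRing rawRing ι

    -- [K : ℚ] = 2
    e₁ e₂       : Carrier
    spanning    : ∀ x → ∃₂ λ p q → x ≈ ι p * e₁ + ι q * e₂
    independent : ∀ p q → ι p * e₁ + ι q * e₂ ≈ 0# → p ≡ 0ℚ × q ≡ 0ℚ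

  IsRational : Carrier → Set ℓ
  IsRational x = ∃[ q ] (x ≈ ι q)

IsMinimizer : (ℤ → ℝ) → ℤ → Set
IsMinimizer g i = ∀ j → g i ≤ʳ g j

IsSmallestMinimizer : (ℤ → ℝ) → ℤ → Set
IsSmallestMinimizer g m = IsMinimizer g m × (∀ i → IsMinimizer g i → m ℤ.≤ i)

fromInteger : ℤ → ℚ
fromInteger i = i ℚ./ 1

-- a⁽⁰⁾ uses the integers 2i, and a⁽¹⁾ the integers i.
stepSize : Fin 2 → ℤ
stepSize 0F = + 2
stepSize 1F = + 1

module _ {c ℓ} (K : QuadraticField c ℓ)
         (σ∞ : QuadraticField.Carrier K → ℝ)
         (σ₂ : QuadraticField.Carrier K → ℚ₂) where

  open QuadraticField K

  PropertyI : Carrier → Set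
  PropertyI α = fromℚ (ℚ.- 1ℚ) <ʳ σ∞ α × σ∞ α ≤ʳ fromℚ 1ℚ × PositiveValuation (σ₂ α)

  -- q = a⁽ᵋ⁾(α), where β = 1/α.
  IsPartialQuotient : Fin 2 → (β : Carrier) → ℚ → Set
  IsPartialQuotient ε β q = ∃[ m ]
    ( IsSmallestMinimizer
        (λ i → ∣ σ∞ β -ʳ fromℚ (fromInteger (stepSize ε ℤ.* i)) -ʳ fromℚ ⌊ σ₂ β ⌋₂ ∣ʳ) m
    × q ≡ fromInteger (stepSize ε ℤ.* m) ℚ.+ ⌊ σ₂ β ⌋₂ )

  -- T ε α α′ : α is nonzero and α′ = T_{2,ε}(α).
  T : Fin 2 → Carrier → Carrier → Set (c ⊔ ℓ)
  T ε α α′ = ∃[ β ] (α * β ≈ 1# × ∃[ q ] (IsPartialQuotient ε β q × α′ ≈ β - ι q))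

  -- The value s 0 is irrelevant: the sequence is indexed by n ≥ 1.
  record GeneratedFrom (α : Carrier) (s : ℕ → Carrier) : Set (c ⊔ ℓ) where
    field
      start : s 1 ≈ α
      even  : ∀ n → 1 ℕ.≤ n → 2 ℕ.∣ n → T 0F (s n) (s (ℕ.suc n))
      odd   : ∀ n → 1 ℕ.≤ n → ¬ (2 ℕ.∣ n) → T 1F (s n) (s (ℕ.suc n))

{-# OPTIONS --safe #-}
module Submission where

-- Lagrange's argument.  From n = 2 on, x = α₍ₙ₎ satisfies an integral equation
-- a x² + b x + c = 0, and one step x ↦ 1/x − q turns (a, b, c) into
-- (c, b + 2qc, a + qb + q²c) and d = 2ax + b into −d.  The new coefficients lie
-- in ℤ[1/2]; since x and d are 2-adically integral, so are they, hence they are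
-- integers.  At the real place the new leading coefficient is a x² − d x, and
-- |x| is at most 1/2 and 1 in turn, so the leading coefficients stay bounded
-- along even n, and with them b = d − 2ax.  A repeated pair (a, b) at two even
-- indices gives a repeated x = (d − b)/(2a), where a ≠ 0 because d is irrational.

open import Defs
open import Algebra.Morphism.Structures using (IsRingHomomorphism; IsRingMonomorphism)
import Algebra.Properties.AbelianGroup as AbelianGroupProperties
import Algebra.Solver.Ring
open import Algebra.Solver.Ring.AlmostCommutativeRing using (fromCommutativeRing; _-Raw-AlmostCommutative⟶_)
open import Data.Empty using (⊥-elim)
open import Data.Fin.Base using (Fin; fromℕ<; toℕ; combine)
open import Data.Fin.Patterns using (0F; 1F)
import Data.Fin.Properties as Fin
open import Data.Integer.Base as ℤ using (ℤ; +_; -[1+_])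
import Data.Integer.DivMod as ℤ
open import Data.Integer.Divisibility.Signed as ℤ∣ using () renaming (_∣_ to _∣ℤ_)
import Data.Integer.Properties as ℤ
open import Data.Integer.Solver renaming (module +-*-Solver to ℤ-Solver)
open import Data.Maybe.Base using (Maybe; just; nothing)
open import Data.Nat.Base as ℕ using (ℕ; zero; suc; _≤_; _<_; _%_)
import Data.Nat.DivMod as ℕ
import Data.Nat.Divisibility as ℕ∣
import Data.Nat.Properties as ℕ
open import Data.Nat.Solver renaming (module +-*-Solver to ℕ-Solver)
open import Data.Product.Base using (∃₂; ∃-syntax; _×_; _,_; proj₁; proj₂)
open import Data.Rational.Base as ℚ using (ℚ; 0ℚ; 1ℚ; ½)
import Data.Rational.Properties as ℚ
open import Data.Rational.Solver renaming (module +-*-Solver to ℚ-Solver)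
import Data.Rational.Unnormalised.Base as ℚᵘ
import Data.Rational.Unnormalised.Properties as ℚᵘ
open import Data.Sum.Base using (inj₁; inj₂)
open import Data.Unit.Base using (tt)
open import Relation.Nullary.Decidable using (yes; no; toWitness)
open import Relation.Nullary.Negation using (¬_)
open import Relation.Binary.PropositionalEquality

-- Lagrange's argument usually controls the conjugate x′ of x. Here d = 2ax + b = a(x - x′) does
-- this job: up to sign it is the same at every step, so a single real bound on d serves the whole
-- orbit. Since the sign alternates, forms are compared only at even indices, where d is literally
-- the same element; this also yields the congruence modulo 2. The alternation of the two maps is
-- essential. With M bounding the leading coefficient and S bounding d, a step from |x| ≤ 1 alone
-- gives only M + S, which may grow forever. A step from |x| ≤ 1/2 contributes a factor 1/4 to M, so
-- two consecutive steps contract. Reals are Cauchy sequences without decidable order, so the bounds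
-- 1/2 and 1 are relaxed to 5/8 and 5/4 with strict rational margins. The product 25/32 is still
-- less than 1, and the contraction survives.

private
  module ℤ-Group = AbelianGroupProperties ℤ.+-0-abelianGroup
  module ℚ-Group = AbelianGroupProperties ℚ.+-0-abelianGroup

-- Integers inside ℚ

-- The three closure conditions are what ring homomorphisms provide: 0, adding 1, and negation. It
-- serves to identify the embeddings on integers.
ℤ-induction : ∀ {p} (P : ℤ → Set p) → P (+ 0) →
              (∀ z → P z → P (+ 1 ℤ.+ z)) → (∀ z → P z → P (ℤ.- z)) → ∀ z → P z
ℤ-induction P P0 P+1 P- = go
  where
  nonNeg : ∀ n → P (+ n)
  nonNeg zero    = P0
  nonNeg (suc n) = P+1 (+ n) (nonNeg n)
  go : ∀ z → P z
  go (+ n)    = nonNeg n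
  go -[1+ n ] = P- (+ suc n) (nonNeg (suc n))

toℚᵘ-fromInteger : ∀ i → ℚ.toℚᵘ (fromInteger i) ℚᵘ.≃ ℚᵘ.mkℚᵘ i 0
toℚᵘ-fromInteger i = ℚ.toℚᵘ-fromℚᵘ (ℚᵘ.mkℚᵘ i 0)

private
  -- `fromInteger` normalises a fraction, so it does not compute on open terms. Passing to
  -- unnormalised rationals turns each homomorphism law into a cross-multiplied identity of
  -- integers.
  reflect : ∀ i {p} → ℚ.toℚᵘ p ℚᵘ.≃ ℚᵘ.mkℚᵘ i 0 → fromInteger i ≡ p
  reflect i eq = ℚ.toℚᵘ-injective (ℚᵘ.≃-trans (toℚᵘ-fromInteger i) (ℚᵘ.≃-sym eq))

fromInteger-+ : ∀ i j → fromInteger (i ℤ.+ j) ≡ fromInteger i ℚ.+ fromInteger j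
fromInteger-+ i j = reflect (i ℤ.+ j) (ℚᵘ.≃-trans (ℚ.toℚᵘ-homo-+ (fromInteger i) (fromInteger j))
  (ℚᵘ.≃-trans (ℚᵘ.+-cong (toℚᵘ-fromInteger i) (toℚᵘ-fromInteger j))
    (ℚᵘ.*≡* (cong (ℤ._* + 1) (cong₂ ℤ._+_ (ℤ.*-identityʳ i) (ℤ.*-identityʳ j))))))

fromInteger-* : ∀ i j → fromInteger (i ℤ.* j) ≡ fromInteger i ℚ.* fromInteger j
fromInteger-* i j = reflect (i ℤ.* j) (ℚᵘ.≃-trans (ℚ.toℚᵘ-homo-* (fromInteger i) (fromInteger j))
  (ℚᵘ.≃-trans (ℚᵘ.*-cong (toℚᵘ-fromInteger i) (toℚᵘ-fromInteger j)) (ℚᵘ.*≡* refl)))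

fromInteger-neg : ∀ i → fromInteger (ℤ.- i) ≡ ℚ.- fromInteger i
fromInteger-neg i = reflect (ℤ.- i) (ℚᵘ.≃-trans (ℚ.toℚᵘ-homo‿- (fromInteger i))
  (ℚᵘ.≃-trans (ℚᵘ.-‿cong (toℚᵘ-fromInteger i)) (ℚᵘ.*≡* refl)))

fromInteger-injective : ∀ {i j} → fromInteger i ≡ fromInteger j → i ≡ j
fromInteger-injective {i} {j} eq
  with ℚᵘ.*≡* e ← ℚᵘ.≃-trans (ℚᵘ.≃-sym (toℚᵘ-fromInteger i))
                    (ℚᵘ.≃-trans (ℚ.toℚᵘ-cong eq) (toℚᵘ-fromInteger j))
  = trans (sym (ℤ.*-identityʳ i)) (trans e (ℤ.*-identityʳ j))

/-numerator : ∀ i n .{{_ : ℕ.NonZero n}} → fromInteger (+ n) ℚ.* (i ℚ./ n) ≡ fromInteger i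
/-numerator i n@(suc n-1) = sym (reflect i (ℚᵘ.≃-trans (ℚ.toℚᵘ-homo-* (fromInteger (+ n)) (i ℚ./ n))
  (ℚᵘ.≃-trans (ℚᵘ.*-cong (toℚᵘ-fromInteger (+ n)) (ℚ.toℚᵘ-fromℚᵘ (ℚᵘ.mkℚᵘ i n-1)))
    (ℚᵘ.*≡* lem))))
  where
  lem : (+ n ℤ.* i) ℤ.* + 1 ≡ i ℤ.* + (suc (n-1 ℕ.+ 0))
  lem rewrite ℕ.+-identityʳ n-1 = trans (ℤ.*-identityʳ _) (ℤ.*-comm (+ n) i)

fromInteger-cancel : ∀ n .{{_ : ℕ.NonZero n}} {p q} →
                     fromInteger (+ n) ℚ.* p ≡ fromInteger (+ n) ℚ.* q → p ≡ q
fromInteger-cancel n {p} {q} eq = ℚ.≤-antisym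
  (ℚ.*-cancelˡ-≤-pos (fromInteger (+ n)) (ℚ.≤-reflexive eq))
  (ℚ.*-cancelˡ-≤-pos (fromInteger (+ n)) (ℚ.≤-reflexive (sym eq)))
  where
  instance
    n+ : ℚ.Positive (fromInteger (+ n))
    n+ = ℚ.normalize-pos n 1

fromInteger-2*≢0 : ∀ {i} → ¬ (i ≡ + 0) → ¬ (fromInteger (+ 2 ℤ.* i) ≡ 0ℚ)
fromInteger-2*≢0 {i} i≢0 eq with ℤ.i*j≡0⇒i≡0∨j≡0 (+ 2) (fromInteger-injective {+ 2 ℤ.* i} {+ 0} eq)
... | inj₂ i≡0 = i≢0 i≡0

-- 2-adic numbers

2^-+ : ∀ m n → 2^ (m ℕ.+ n) ≡ 2^ m ℤ.* 2^ n
2^-+ m n = trans (cong +_ (ℕ.^-distribˡ-+-* 2 m n)) (ℤ.pos-* (2 ℕ.^ m) (2 ℕ.^ n))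

2^-cancel-∣ : ∀ n {x y} → 2^ n ℤ.* x ∣ℤ 2^ n ℤ.* y → x ∣ℤ y
2^-cancel-∣ n = ℤ∣.*-cancelˡ-∣ (2^ n) {{ℕ.m^n≢0 2 n}}

∣-respʳ : ∀ {d x y} → x ≡ y → d ∣ℤ x → d ∣ℤ y
∣-respʳ {d} = subst (d ∣ℤ_)

∣-*-* : ∀ {a b c d} → a ∣ℤ b → c ∣ℤ d → a ℤ.* c ∣ℤ b ℤ.* d
∣-*-* {a} {b} {c} {d} p q = ℤ∣.∣-trans (ℤ∣.*-monoˡ-∣ c p) (ℤ∣.*-monoʳ-∣ b q)

2^-∣ : ∀ {m n} → m ℕ.≤ n → 2^ m ∣ℤ 2^ n
2^-∣ {m} {n} m≤n = subst (2^ m ∣ℤ_) (trans (sym (2^-+ m (n ℕ.∸ m))) (cong 2^ (ℕ.m+[n∸m]≡n m≤n)))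
  (ℤ∣.∣m⇒∣m*n (2^ (n ℕ.∸ m)) ℤ∣.∣-refl)

coherent-≤ : ∀ a {m n} → m ℕ.≤ n → 2^ m ∣ℤ app a n ℤ.- app a m
coherent-≤ a {m} m≤n = go (ℕ.≤⇒≤′ m≤n)
  where
  open ℤ-Solver
  go : ∀ {n} → m ℕ.≤′ n → 2^ m ∣ℤ app a n ℤ.- app a m
  go ℕ.≤′-refl = ∣-respʳ (sym (ℤ.+-inverseʳ (app a m))) (ℤ∣.divides (+ 0) refl)
  go {suc n} (ℕ.≤′-step p) = ∣-respʳ
    (solve 3 (λ x y z → (x :- y) :+ (y :- z) := x :- z) refl (app a (suc n)) (app a n) (app a m))
    (ℤ∣.∣m∣n⇒∣m+n (ℤ∣.∣-trans (2^-∣ (ℕ.≤′⇒≤ p)) (coherent a n)) (go p))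

private
  ∣-shift : ∀ {d} x y → d ∣ℤ x ℤ.- y → d ∣ℤ y → d ∣ℤ x
  ∣-shift x y p q = ∣-respʳ (solve 2 (λ x y → (x :- y) :+ y := x) refl x y) (ℤ∣.∣m∣n⇒∣m+n p q)
    where open ℤ-Solver

  ∣-shift′ : ∀ {d} x y → d ∣ℤ x ℤ.- y → d ∣ℤ x → d ∣ℤ y
  ∣-shift′ x y p q = ∣-respʳ (solve 2 (λ x y → x :- (x :- y) := y) refl x y) (ℤ∣.∣m∣n⇒∣m-n q p)
    where open ℤ-Solver

-- By coherence, divisibility by 2^m may be tested at any level from m on. With `lower`, this lets
-- numbers with different denominators be compared at a common level.
raise : ∀ a {m n} → m ℕ.≤ n → 2^ m ∣ℤ app a m → 2^ m ∣ℤ app a n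
raise a {m} {n} m≤n = ∣-shift (app a n) (app a m) (coherent-≤ a m≤n)

lower : ∀ a {m n} → m ℕ.≤ n → 2^ m ∣ℤ app a n → 2^ m ∣ℤ app a m
lower a {m} {n} m≤n = ∣-shift′ (app a n) (app a m) (coherent-≤ a m≤n)

≈₂-sym : ∀ {u v} → u ≈₂ v → v ≈₂ u
≈₂-sym {a /2^ k} {b /2^ l} eq n = ∣-respʳ (lem (2^ l ℤ.* app a n) (2^ k ℤ.* app b n)) (ℤ∣.∣m⇒∣-m (eq n))
  where
  open ℤ-Solver
  lem : ∀ x y → ℤ.- (x ℤ.- y) ≡ y ℤ.- x
  lem = solve 2 (λ x y → :- (x :- y) := y :- x) refl

≈₂-trans : ∀ {u v w} → u ≈₂ v → v ≈₂ w → u ≈₂ w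
≈₂-trans {a /2^ k} {b /2^ l} {c /2^ m} eq₁ eq₂ n = result
  where
  open ℤ-Solver
  -- Eliminating the middle term leaves a factor 2^l, and cancelling it costs l levels. The
  -- hypotheses are therefore used at level l + n, and coherence brings the result back down to
  -- level n.
  N = l ℕ.+ n
  n≤N = ℕ.m≤n+m n l
  scaled : 2^ l ℤ.* 2^ n ∣ℤ 2^ l ℤ.* (2^ m ℤ.* app a N ℤ.- 2^ k ℤ.* app c N)
  scaled = subst₂ _∣ℤ_ (2^-+ l n)
    (solve 6 (λ K L M a b c → M :* (L :* a :- K :* b) :+ K :* (M :* b :- L :* c) :=
                              L :* (M :* a :- K :* c)) refl
       (2^ k) (2^ l) (2^ m) (app a N) (app b N) (app c N))
    (ℤ∣.∣m∣n⇒∣m+n (ℤ∣.∣n⇒∣m*n (2^ m) (eq₁ N)) (ℤ∣.∣n⇒∣m*n (2^ k) (eq₂ N)))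
  result : 2^ n ∣ℤ 2^ m ℤ.* app a n ℤ.- 2^ k ℤ.* app c n
  result = ∣-respʳ
    (solve 6 (λ K M a a′ c c′ → (M :* a′ :- K :* c′) :- (M :* (a′ :- a) :- K :* (c′ :- c)) :=
                                M :* a :- K :* c) refl
       (2^ k) (2^ m) (app a n) (app a N) (app c n) (app c N))
    (ℤ∣.∣m∣n⇒∣m-n (2^-cancel-∣ l scaled)
      (ℤ∣.∣m∣n⇒∣m-n (ℤ∣.∣n⇒∣m*n (2^ m) (coherent-≤ a n≤N)) (ℤ∣.∣n⇒∣m*n (2^ k) (coherent-≤ c n≤N))))

+₂-cong : ∀ {u u′ v v′} → u ≈₂ u′ → v ≈₂ v′ → u +₂ v ≈₂ u′ +₂ v′
+₂-cong {a /2^ k} {a′ /2^ k′} {b /2^ l} {b′ /2^ l′} eq₁ eq₂ n =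
  subst₂ (λ s t → 2^ n ∣ℤ s ℤ.* (2^ l ℤ.* app a n ℤ.+ 2^ k ℤ.* app b n) ℤ.- t ℤ.*
      (2^ l′ ℤ.* app a′ n ℤ.+ 2^ k′ ℤ.* app b′ n))
    (sym (2^-+ k′ l′)) (sym (2^-+ k l))
    (∣-respʳ (lem (2^ k) (2^ l) (2^ k′) (2^ l′) (app a n) (app b n) (app a′ n) (app b′ n))
      (ℤ∣.∣m∣n⇒∣m+n (ℤ∣.∣n⇒∣m*n (2^ l ℤ.* 2^ l′) (eq₁ n)) (ℤ∣.∣n⇒∣m*n (2^ k ℤ.* 2^ k′) (eq₂ n))))
  where
  open ℤ-Solver
  lem : ∀ K L K′ L′ a b a′ b′ → _
  lem = solve 8 (λ K L K′ L′ a b a′ b′ →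
    (L :* L′) :* (K′ :* a :- K :* a′) :+ (K :* K′) :* (L′ :* b :- L :* b′) :=
    (K′ :* L′) :* (L :* a :+ K :* b) :- (K :* L) :* (L′ :* a′ :+ K′ :* b′)) refl

*₂-cong : ∀ {u u′ v v′} → u ≈₂ u′ → v ≈₂ v′ → u *₂ v ≈₂ u′ *₂ v′
*₂-cong {a /2^ k} {a′ /2^ k′} {b /2^ l} {b′ /2^ l′} eq₁ eq₂ n =
  subst₂ (λ s t → 2^ n ∣ℤ s ℤ.* (app a n ℤ.* app b n) ℤ.- t ℤ.* (app a′ n ℤ.* app b′ n))
    (sym (2^-+ k′ l′)) (sym (2^-+ k l))
    (∣-respʳ (lem (2^ k) (2^ l) (2^ k′) (2^ l′) (app a n) (app b n) (app a′ n) (app b′ n))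
      (ℤ∣.∣m∣n⇒∣m+n (ℤ∣.∣n⇒∣m*n (2^ l′ ℤ.* app b n) (eq₁ n)) (ℤ∣.∣n⇒∣m*n (2^ k ℤ.* app a′ n) (eq₂ n))))
  where
  open ℤ-Solver
  lem : ∀ K L K′ L′ a b a′ b′ → _
  lem = solve 8 (λ K L K′ L′ a b a′ b′ →
    (L′ :* b) :* (K′ :* a :- K :* a′) :+ (K :* a′) :* (L′ :* b :- L :* b′) :=
    (K′ :* L′) :* (a :* b) :- (K :* L) :* (a′ :* b′)) refl

-₂-cong : ∀ {u v} → u ≈₂ v → -₂ u ≈₂ -₂ v
-₂-cong {a /2^ k} {b /2^ l} eq n = ∣-respʳ
  (solve 4 (λ K L a b → :- (L :* a :- K :* b) := L :* (:- a) :- K :* (:- b)) refl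
    (2^ k) (2^ l) (app a n) (app b n))
  (ℤ∣.∣m⇒∣-m (eq n))
  where open ℤ-Solver

-- v₂(u) ≥ j, which holds of u = 0 for every j (unlike HasValuation).
ValuationAtLeast : ℕ → ℚ₂ → Set
ValuationAtLeast j u = 2^ (j ℕ.+ exp u) ∣ℤ app (num u) (j ℕ.+ exp u)

private
  2^-split : ∀ {m} n o → m ≡ n ℕ.+ o → 2^ m ≡ 2^ n ℤ.* 2^ o
  2^-split n o eq = trans (cong 2^ eq) (2^-+ n o)

  j+[k+l]≡l+[j+k] : ∀ j k l → j ℕ.+ (k ℕ.+ l) ≡ l ℕ.+ (j ℕ.+ k)
  j+[k+l]≡l+[j+k] = solve 3 (λ j k l → j :+ (k :+ l) := l :+ (j :+ k)) refl
    where open ℕ-Solver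

  j+[k+l]≡k+[j+l] : ∀ j k l → j ℕ.+ (k ℕ.+ l) ≡ k ℕ.+ (j ℕ.+ l)
  j+[k+l]≡k+[j+l] = solve 3 (λ j k l → j :+ (k :+ l) := k :+ (j :+ l)) refl
    where open ℕ-Solver

  interchange : ∀ i j k l → i ℕ.+ j ℕ.+ (k ℕ.+ l) ≡ i ℕ.+ k ℕ.+ (j ℕ.+ l)
  interchange = solve 4 (λ i j k l → i :+ j :+ (k :+ l) := i :+ k :+ (j :+ l)) refl
    where open ℕ-Solver

valuation-+ : ∀ j u v → ValuationAtLeast j u → ValuationAtLeast j v → ValuationAtLeast j (u +₂ v)
valuation-+ j (a /2^ k) (b /2^ l) p q = ℤ∣.∣m∣n⇒∣m+n
  (subst (_∣ℤ 2^ l ℤ.* app a N) (sym (2^-split l (j ℕ.+ k) (j+[k+l]≡l+[j+k] j k l)))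
    (ℤ∣.*-monoʳ-∣ (2^ l) (raise a (ℕ.+-monoʳ-≤ j (ℕ.m≤m+n k l)) p)))
  (subst (_∣ℤ 2^ k ℤ.* app b N) (sym (2^-split k (j ℕ.+ l) (j+[k+l]≡k+[j+l] j k l)))
    (ℤ∣.*-monoʳ-∣ (2^ k) (raise b (ℕ.+-monoʳ-≤ j (ℕ.m≤n+m l k)) q)))
  where N = j ℕ.+ (k ℕ.+ l)

valuation-* : ∀ i j u v → ValuationAtLeast i u → ValuationAtLeast j v →
              ValuationAtLeast (i ℕ.+ j) (u *₂ v)
valuation-* i j (a /2^ k) (b /2^ l) p q =
  subst (_∣ℤ app a N ℤ.* app b N) (sym (2^-split (i ℕ.+ k) (j ℕ.+ l) (interchange i j k l)))
    (∣-*-* (raise a (ℕ.+-mono-≤ (ℕ.m≤m+n i j) (ℕ.m≤m+n k l)) p)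
           (raise b (ℕ.+-mono-≤ (ℕ.m≤n+m j i) (ℕ.m≤n+m l k)) q))
  where N = i ℕ.+ j ℕ.+ (k ℕ.+ l)

valuation-neg : ∀ j u → ValuationAtLeast j u → ValuationAtLeast j (-₂ u)
valuation-neg j u = ℤ∣.∣m⇒∣-m

-- At level N = j + (k + l) the products 2^l a and 2^k b agree modulo 2^N, and 2^N divides the
-- first. Cancelling 2^k from the second leaves 2^(j + l) dividing b.
valuation-resp : ∀ j {u v} → u ≈₂ v → ValuationAtLeast j u → ValuationAtLeast j v
valuation-resp j {a /2^ k} {b /2^ l} eq p =
  lower b (ℕ.+-monoʳ-≤ j (ℕ.m≤n+m l k))
    (2^-cancel-∣ k (subst (_∣ℤ 2^ k ℤ.* app b N) (2^-split k (j ℕ.+ l) (j+[k+l]≡k+[j+l] j k l))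
      (∣-shift′ (2^ l ℤ.* app a N) (2^ k ℤ.* app b N) (eq N)
        (subst (_∣ℤ 2^ l ℤ.* app a N) (sym (2^-split l (j ℕ.+ k) (j+[k+l]≡l+[j+k] j k l)))
          (ℤ∣.*-monoʳ-∣ (2^ l) (raise a (ℕ.+-monoʳ-≤ j (ℕ.m≤m+n k l)) p))))))
  where N = j ℕ.+ (k ℕ.+ l)

fromℤ₂ : ℤ → ℚ₂
fromℤ₂ z = fromℤ z /2^ 0

valuation-fromℤ₂ : ∀ j z → ValuationAtLeast j (fromℤ₂ z) → 2^ j ∣ℤ z
valuation-fromℤ₂ j z = subst (λ n → 2^ n ∣ℤ z) (ℕ.+-identityʳ j)

fromℤ₂-valuation : ∀ j z → 2^ j ∣ℤ z → ValuationAtLeast j (fromℤ₂ z)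
fromℤ₂-valuation j z = subst (λ n → 2^ n ∣ℤ z) (sym (ℕ.+-identityʳ j))

valuation-2^-* : ∀ k u → ValuationAtLeast k (fromℤ₂ (2^ k) *₂ u) → ValuationAtLeast 0 u
valuation-2^-* k (a /2^ l) p = lower a (ℕ.m≤n+m l k)
  (2^-cancel-∣ k (subst (_∣ℤ 2^ k ℤ.* app a (k ℕ.+ l)) (2^-+ k l) p))

-- The floor

module Floor (a : ℤ₂) where
  residue : ℕ → ℕ
  residue n = ℤ._%ℕ_ (app a n) (2 ℕ.^ n) {{ℕ.m^n≢0 2 n}}

  residue-∣ : ∀ n → 2^ n ∣ℤ app a n ℤ.- + residue n
  residue-∣ n = ℤ∣.divides (app a n ℤ./ℕ (2 ℕ.^ n)) (begin
    app a n ℤ.- + residue n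
      ≡⟨ cong (ℤ._- + residue n) (ℤ.a≡a%ℕn+[a/ℕn]*n (app a n) (2 ℕ.^ n)) ⟩
    + residue n ℤ.+ app a n ℤ./ℕ (2 ℕ.^ n) ℤ.* 2^ n ℤ.- + residue n
      ≡⟨ solve 2 (λ x y → x :+ y :- x := y) refl (+ residue n) (app a n ℤ./ℕ (2 ℕ.^ n) ℤ.* 2^ n) ⟩
    app a n ℤ./ℕ (2 ℕ.^ n) ℤ.* 2^ n ∎)
    where
    open ≡-Reasoning
    open ℤ-Solver
    instance _ = ℕ.m^n≢0 2 n

  residue-unique : ∀ n x y → x ℕ.< 2 ℕ.^ n → y ℕ.< 2 ℕ.^ n → 2^ n ∣ℤ + x ℤ.- + y → x ≡ y
  residue-unique n x y x< y< p with ℤ.∣ + x ℤ.- + y ∣ in eq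
  ... | zero = ℤ.+-injective (ℤ.i-j≡0⇒i≡j (+ x) (+ y) (ℤ.∣i∣≡0⇒i≡0 eq))
  ... | suc d = ⊥-elim (ℕ∣.>⇒∤ (subst (ℕ._< 2 ℕ.^ n) eq small) (subst (2 ℕ.^ n ℕ∣.∣_) eq (ℤ∣.∣⇒∣ᵤ p)))
    where
    small : ℤ.∣ + x ℤ.- + y ∣ ℕ.< 2 ℕ.^ n
    small = ℕ.≤-<-trans (subst (λ t → ℤ.∣ t ∣ ℕ.≤ x ℕ.⊔ y) (sym (ℤ.m-n≡m⊖n x y)) (ℤ.∣m⊝n∣≤m⊔n x y))
        (ℕ.⊔-pres-<m x< y<)

  -- Removing the top binary digit of the residue modulo 2^(n+1) leaves a number in [0, 2^n) that
  -- coherence makes congruent to the residue modulo 2^n; two such numbers coincide.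
  residue-suc : ∀ n → residue (suc n) ≡ residue n ℕ.+ digitᶻ a n ℕ.* 2 ℕ.^ n
  residue-suc n = trans (ℕ.m≡m%n+[m/n]*n R (2 ℕ.^ n))
    (cong (ℕ._+ digitᶻ a n ℕ.* 2 ℕ.^ n)
      (residue-unique n (R ℕ.% 2 ℕ.^ n) (residue n) (ℕ.m%n<n R (2 ℕ.^ n))
        (ℤ.n%ℕd<d (app a n) (2 ℕ.^ n)) congruent))
    where
    open ℤ-Solver
    instance _ = ℕ.m^n≢0 2 n
    R = residue (suc n)
    R-digit : 2^ n ∣ℤ + R ℤ.- + (R ℕ.% 2 ℕ.^ n)
    R-digit = ℤ∣.divides (+ digitᶻ a n) (begin
      + R ℤ.- + r                          ≡⟨ cong (λ t → + t ℤ.- + r) (ℕ.m≡m%n+[m/n]*n R (2 ℕ.^ n)) ⟩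
      + (r ℕ.+ d) ℤ.- + r                  ≡⟨ cong (ℤ._- + r) (ℤ.pos-+ r d) ⟩
      + r ℤ.+ + d ℤ.- + r                  ≡⟨ solve 2 (λ x y → x :+ y :- x := y) refl (+ r) (+ d) ⟩
      + d                                  ≡⟨ ℤ.pos-* (digitᶻ a n) (2 ℕ.^ n) ⟩
      + digitᶻ a n ℤ.* 2^ n                ∎)
      where
      open ≡-Reasoning
      r = R ℕ.% 2 ℕ.^ n
      d = digitᶻ a n ℕ.* 2 ℕ.^ n
    congruent : 2^ n ∣ℤ + (R ℕ.% 2 ℕ.^ n) ℤ.- + residue n
    congruent = ∣-respʳ
      (solve 5 (λ r R a′ a x → (a′ :- a) :- (a′ :- R) :+ (a :- x) :- (R :- r) := r :- x) refl
        (+ (R ℕ.% 2 ℕ.^ n)) (+ R) (app a (suc n)) (app a n) (+ residue n))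
      (ℤ∣.∣m∣n⇒∣m-n (ℤ∣.∣m∣n⇒∣m+n (ℤ∣.∣m∣n⇒∣m-n (coherent a n)
         (ℤ∣.∣-trans (2^-∣ (ℕ.n≤1+n n)) (residue-∣ (suc n)))) (residue-∣ n)) R-digit)

  residue-0 : residue 0 ≡ 0
  residue-0 = ℕ.n<1⇒n≡0 (ℤ.n%ℕd<d (app a 0) 1)

  term : ∀ k j → ℚ
  term k j = ℚ._/_ (+ digit (a /2^ k) (ℤ.- + j)) (2 ℕ.^ j) {{ℕ.m^n≢0 2 j}}

  digit-≤ : ∀ {k j} → j ℕ.≤ k → digit (a /2^ k) (ℤ.- + j) ≡ digitᶻ a (k ℕ.∸ j)
  digit-≤ {k} {j} j≤k rewrite trans (ℤ.-m+n≡n⊖m j k) (ℤ.⊖-≥ j≤k) = refl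

  scaled-term : ∀ {k j} → j ℕ.≤ k →
    fromInteger (2^ k) ℚ.* term k j ≡ fromInteger (+ (digitᶻ a (k ℕ.∸ j) ℕ.* 2 ℕ.^ (k ℕ.∸ j)))
  scaled-term {k} {j} j≤k = begin
    fromInteger (2^ k) ℚ.* term k j
      ≡⟨ cong (λ d → fromInteger (2^ k) ℚ.* ℚ._/_ (+ d) (2 ℕ.^ j) {{ℕ.m^n≢0 2 j}}) (digit-≤ j≤k) ⟩
    fromInteger (2^ k) ℚ.* t                    ≡⟨ cong (λ z → fromInteger z ℚ.* t) split ⟩
    fromInteger (2^ i ℤ.* 2^ j) ℚ.* t           ≡⟨ cong (ℚ._* t) (fromInteger-* (2^ i) (2^ j)) ⟩
    fromInteger (2^ i) ℚ.* fromInteger (2^ j) ℚ.* t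
      ≡⟨ ℚ.*-assoc (fromInteger (2^ i)) (fromInteger (2^ j)) t ⟩
    fromInteger (2^ i) ℚ.* (fromInteger (2^ j) ℚ.* t)
      ≡⟨ cong (fromInteger (2^ i) ℚ.*_) (/-numerator (+ d) (2 ℕ.^ j) {{ℕ.m^n≢0 2 j}}) ⟩
    fromInteger (2^ i) ℚ.* fromInteger (+ d)    ≡⟨ fromInteger-* (2^ i) (+ d) ⟨
    fromInteger (2^ i ℤ.* + d)
      ≡⟨ cong fromInteger (trans (ℤ.*-comm (2^ i) (+ d)) (sym (ℤ.pos-* d (2 ℕ.^ i)))) ⟩
    fromInteger (+ (d ℕ.* 2 ℕ.^ i))             ∎
    where
    open ≡-Reasoning
    i = k ℕ.∸ j
    d = digitᶻ a i
    t = ℚ._/_ (+ d) (2 ℕ.^ j) {{ℕ.m^n≢0 2 j}}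
    split : 2^ k ≡ 2^ i ℤ.* 2^ j
    split = trans (cong 2^ (sym (ℕ.m∸n+n≡m j≤k))) (2^-+ i j)

  residue-sucℚ : ∀ n → fromInteger (+ residue (suc n)) ≡
                 fromInteger (+ (digitᶻ a n ℕ.* 2 ℕ.^ n)) ℚ.+ fromInteger (+ residue n)
  residue-sucℚ n = trans (cong (λ r → fromInteger (+ r))
      (trans (residue-suc n) (ℕ.+-comm (residue n) _)))
    (trans (cong fromInteger (ℤ.pos-+ (digitᶻ a n ℕ.* 2 ℕ.^ n) (residue n)))
      (fromInteger-+ (+ (digitᶻ a n ℕ.* 2 ℕ.^ n)) (+ residue n)))

  -- A telescoping sum: after scaling by 2^k, term j is the digit at position k - j with its place
  -- value, so the sum reads the digits downwards from position k, and `residue (k ∸ j)` is the part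
  -- still unread.
  partial-sum : ∀ k j → j ℕ.≤ k →
    fromInteger (2^ k) ℚ.* Σ≤ j (term k) ℚ.+ fromInteger (+ residue (k ℕ.∸ j)) ≡
    fromInteger (+ residue (suc k))
  partial-sum k zero j≤k =
    trans (cong (ℚ._+ fromInteger (+ residue k)) (scaled-term {k} {0} j≤k)) (sym (residue-sucℚ k))
  partial-sum k (suc j) j<k = begin
    q ℚ.* (S ℚ.+ t) ℚ.+ r          ≡⟨ solve 4
        (λ q S t r → q :* (S :+ t) :+ r := q :* S :+ (q :* t :+ r)) refl q S t r ⟩
    q ℚ.* S ℚ.+ (q ℚ.* t ℚ.+ r)    ≡⟨ cong (λ x → q ℚ.* S ℚ.+ (x ℚ.+ r)) (scaled-term {k} {suc j} j<k) ⟩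
    q ℚ.* S ℚ.+ (fromInteger (+ (digitᶻ a i ℕ.* 2 ℕ.^ i)) ℚ.+ r)
                                   ≡⟨ cong (q ℚ.* S ℚ.+_) (residue-sucℚ i) ⟨
    q ℚ.* S ℚ.+ fromInteger (+ residue (suc i))
      ≡⟨ cong (λ n → q ℚ.* S ℚ.+ fromInteger (+ residue n)) (ℕ.+-∸-assoc 1 j<k) ⟨
    q ℚ.* S ℚ.+ fromInteger (+ residue (k ℕ.∸ j))  ≡⟨ partial-sum k j (ℕ.<⇒≤ j<k) ⟩
    fromInteger (+ residue (suc k)) ∎
    where
    open ≡-Reasoning
    open ℚ-Solver
    i = k ℕ.∸ suc j
    q = fromInteger (2^ k)
    S = Σ≤ j (term k)
    t = term k (suc j)
    r = fromInteger (+ residue i)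

  -- The digit c₀ of a / 2^k is digit k of a and belongs to the floor, hence the residue modulo
  -- 2^(k+1) and not modulo 2^k.
  scaled-floor : ∀ k → fromInteger (2^ k) ℚ.* ⌊ a /2^ k ⌋₂ ≡ fromInteger (+ residue (suc k))
  scaled-floor k = begin
    q ℚ.* S                                          ≡⟨ ℚ.+-identityʳ (q ℚ.* S) ⟨
    q ℚ.* S ℚ.+ fromInteger (+ 0)                    ≡⟨ cong
        (λ n → q ℚ.* S ℚ.+ fromInteger (+ n)) residue-0 ⟨
    q ℚ.* S ℚ.+ fromInteger (+ residue 0)            ≡⟨ cong
        (λ n → q ℚ.* S ℚ.+ fromInteger (+ residue n)) (ℕ.n∸n≡0 k) ⟨
    q ℚ.* S ℚ.+ fromInteger (+ residue (k ℕ.∸ k))    ≡⟨ partial-sum k k ℕ.≤-refl ⟩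
    fromInteger (+ residue (suc k))                  ∎
    where
    open ≡-Reasoning
    q = fromInteger (2^ k)
    S = ⌊ a /2^ k ⌋₂

-- Level 2k, for k = `exp u`, is the one at which `ValuationAtLeast k` inspects a number with
-- denominator 2^k. A congruence modulo 2^k is enough to make u minus its floor integral.
scaled-floor : ∀ u → ∃[ z ] (fromInteger (2^ (exp u)) ℚ.* ⌊ u ⌋₂ ≡ fromInteger z ×
                             2^ (exp u) ∣ℤ app (num u) (exp u ℕ.+ exp u) ℤ.- z)
scaled-floor (a /2^ k) = + F.residue (suc k) , F.scaled-floor k , ∣-respʳ
  (solve 3 (λ x y z → (x :- z) :+ (z :- y) := x :- y) refl (app a (k ℕ.+ k)) (+ F.residue (suc k))
      (app a k))
  (ℤ∣.∣m∣n⇒∣m+n (coherent-≤ a (ℕ.m≤m+n k k)) (∣-respʳ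
    (solve 3 (λ x y z → (x :- y) :- (x :- z) := z :- y) refl (app a (suc k)) (+ F.residue (suc k))
        (app a k))
    (ℤ∣.∣m∣n⇒∣m-n (ℤ∣.∣-trans (2^-∣ (ℕ.n≤1+n k)) (F.residue-∣ (suc k))) (coherent a k))))
  where
  module F = Floor a
  open ℤ-Solver

-- Everything is scaled by 2^k so that the floor becomes an integer z: `σ₂` will be computed
-- explicitly on integers, not on all rationals. Dividing by 2^k afterwards gives integrality.
valuation-approximation : ∀ u z → 2^ (exp u) ∣ℤ app (num u) (exp u ℕ.+ exp u) ℤ.- z →
                          ValuationAtLeast (exp u) (fromℤ₂ (2^ (exp u)) *₂ u +₂ fromℤ₂ (ℤ.- z))
valuation-approximation (a /2^ k) z h = subst
  (λ e → 2^ (k ℕ.+ e) ∣ℤ + 1 ℤ.* (2^ k ℤ.* app a (k ℕ.+ e)) ℤ.+ 2^ k ℤ.* ℤ.- z)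
  (sym (ℕ.+-identityʳ k))
  (subst₂ _∣ℤ_ (sym (2^-+ k k)) (lem (2^ k) (app a (k ℕ.+ k)) z) (ℤ∣.*-monoʳ-∣ (2^ k) h))
  where
  open ℤ-Solver
  lem : ∀ K a z → K ℤ.* (a ℤ.- z) ≡ + 1 ℤ.* (K ℤ.* a) ℤ.+ K ℤ.* ℤ.- z
  lem = solve 3 (λ K a z → K :* (a :- z) := con (+ 1) :* (K :* a) :+ K :* :- z) refl

-- Rational inequalities

-- Linear consequences of a (sum of) hypotheses p < q are obtained by checking
-- the identity b - a = q - p with the ring solver.
linear-< : ∀ {p q a b} → p ℚ.< q → b ℚ.- a ≡ q ℚ.- p → a ℚ.< b
linear-< {p} {q} {a} {b} p<q eq = subst₂ ℚ._<_ (lem a p) eq′ (ℚ.+-monoʳ-< (a ℚ.- p) p<q)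
  where
  open ℚ-Solver
  lem : ∀ a p → a ℚ.- p ℚ.+ p ≡ a
  lem = solve 2 (λ a p → a :- p :+ p := a) refl
  lem₁ : ∀ a p q → a ℚ.- p ℚ.+ q ≡ a ℚ.+ (q ℚ.- p)
  lem₁ = solve 3 (λ a p q → a :- p :+ q := a :+ (q :- p)) refl
  lem₂ : ∀ a b → a ℚ.+ (b ℚ.- a) ≡ b
  lem₂ = solve 2 (λ a b → a :+ (b :- a) := b) refl
  eq′ : a ℚ.- p ℚ.+ q ≡ b
  eq′ = trans (lem₁ a p q) (trans (cong (a ℚ.+_) (sym eq)) (lem₂ a b))

p≤∣p∣ : ∀ p → p ℚ.≤ ℚ.∣ p ∣
p≤∣p∣ p with ℚ.≤-total 0ℚ p
... | inj₁ 0≤p = ℚ.≤-reflexive (sym (ℚ.0≤p⇒∣p∣≡p 0≤p))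
... | inj₂ p≤0 = ℚ.≤-trans p≤0 (ℚ.0≤∣p∣ p)

-p≤∣p∣ : ∀ p → ℚ.- p ℚ.≤ ℚ.∣ p ∣
-p≤∣p∣ p = subst (ℚ.- p ℚ.≤_) (ℚ.∣-p∣≡∣p∣ p) (p≤∣p∣ (ℚ.- p))

∣p∣<q : ∀ {p q} → p ℚ.< q → ℚ.- p ℚ.< q → ℚ.∣ p ∣ ℚ.< q
∣p∣<q {p} h k with ℚ.∣p∣≡p∨∣p∣≡-p p
... | inj₁ e = subst (ℚ._< _) (sym e) h
... | inj₂ e = subst (ℚ._< _) (sym e) k

∣p-q∣≡∣q-p∣ : ∀ p q → ℚ.∣ p ℚ.- q ∣ ≡ ℚ.∣ q ℚ.- p ∣
∣p-q∣≡∣q-p∣ p q = trans (sym (ℚ.∣-p∣≡∣p∣ (p ℚ.- q))) (cong ℚ.∣_∣ (lem p q))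
  where
  open ℚ-Solver
  lem : ∀ p q → ℚ.- (p ℚ.- q) ≡ q ℚ.- p
  lem = solve 2 (λ p q → :- (p :- q) := q :- p) refl

∣+∣-< : ∀ p q {r s} → ℚ.∣ p ∣ ℚ.< r → ℚ.∣ q ∣ ℚ.< s → ℚ.∣ p ℚ.+ q ∣ ℚ.< r ℚ.+ s
∣+∣-< p q h k = ℚ.≤-<-trans (ℚ.∣p+q∣≤∣p∣+∣q∣ p q) (ℚ.+-mono-< h k)

∣∣-perturb : ∀ p q {r s} → ℚ.∣ p ∣ ℚ.< r → ℚ.∣ p ℚ.- q ∣ ℚ.< s → ℚ.∣ q ∣ ℚ.< r ℚ.+ s
∣∣-perturb p q {r} {s} h k = subst (λ t → ℚ.∣ t ∣ ℚ.< r ℚ.+ s) (lem p q)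
  (∣+∣-< p (q ℚ.- p) h (subst (ℚ._< s) (∣p-q∣≡∣q-p∣ p q) k))
  where
  open ℚ-Solver
  lem : ∀ p q → p ℚ.+ (q ℚ.- p) ≡ q
  lem = solve 2 (λ p q → p :+ (q :- p) := q) refl

*-mono-<-nonNeg : ∀ {p q r s} → 0ℚ ℚ.≤ p → 0ℚ ℚ.≤ r → p ℚ.< q → r ℚ.< s → p ℚ.* r ℚ.< q ℚ.* s
*-mono-<-nonNeg {p} {q} {r} {s} 0≤p 0≤r p<q r<s = ℚ.≤-<-trans
  (ℚ.*-monoˡ-≤-nonNeg p {{ℚ.nonNegative 0≤p}} (ℚ.<⇒≤ r<s))
  (ℚ.*-monoˡ-<-pos s {{ℚ.positive (ℚ.≤-<-trans 0≤r r<s)}} p<q)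

room : ∀ {p q} → p ℚ.< q → ∃[ ε ] (0ℚ ℚ.< ε × p ℚ.+ ε ℚ.< q)
room {p} {q} p<q with ℚ.<-dense p<q
... | m , p<m , m<q = m ℚ.- p , linear-< p<m (lem₁ p m) , linear-< m<q (lem₂ p m q)
  where
  open ℚ-Solver
  lem₁ : ∀ p m → m ℚ.- p ℚ.- 0ℚ ≡ m ℚ.- p
  lem₁ p m = ℚ.+-identityʳ (m ℚ.- p)
  lem₂ : ∀ p m q → q ℚ.- (p ℚ.+ (m ℚ.- p)) ≡ q ℚ.- m
  lem₂ = solve 3 (λ p m q → q :- (p :+ (m :- p)) := q :- m) refl

p<p+ε : ∀ p {ε} → 0ℚ ℚ.< ε → p ℚ.< p ℚ.+ ε
p<p+ε p {ε} ε>0 = subst (ℚ._< p ℚ.+ ε) (ℚ.+-identityʳ p) (ℚ.+-monoʳ-< p ε>0)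

-- Real numbers

≈ʳ-pointwise : ∀ {x y} → (∀ n → seq x n ≡ seq y n) → x ≈ʳ y
≈ʳ-pointwise {x} {y} eq ε ε>0 = 0 , λ n _ → subst (ℚ._< ε)
  (sym (cong ℚ.∣_∣ (trans (cong (λ t → t ℚ.- seq y n) (eq n)) (ℚ.+-inverseʳ (seq y n))))) ε>0

≈ʳ-sym : ∀ {x y} → x ≈ʳ y → y ≈ʳ x
≈ʳ-sym {x} {y} eq ε ε>0 with eq ε ε>0
... | N , h = N , λ n N≤n → subst (ℚ._< ε) (∣p-q∣≡∣q-p∣ (seq x n) (seq y n)) (h n N≤n)

private
  half>0 : ∀ {ε} → 0ℚ ℚ.< ε → 0ℚ ℚ.< ½ ℚ.* ε
  half>0 {ε} h = subst (ℚ._< ½ ℚ.* ε) (ℚ.*-zeroʳ ½) (ℚ.*-monoʳ-<-pos ½ h)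

  half+half : ∀ ε → ½ ℚ.* ε ℚ.+ ½ ℚ.* ε ≡ ε
  half+half ε = trans (sym (ℚ.*-distribʳ-+ ε ½ ½)) (ℚ.*-identityˡ ε)

  add-close : ∀ {x y z w v t} →
    (∀ n → (seq x n ℚ.- seq y n) ℚ.+ (seq z n ℚ.- seq w n) ≡ seq v n ℚ.- seq t n) →
    x ≈ʳ y → z ≈ʳ w → v ≈ʳ t
  add-close {x} {y} {z} {w} eq p q ε ε>0 with p (½ ℚ.* ε) (half>0 ε>0) | q (½ ℚ.* ε) (half>0 ε>0)
  ... | M , h | N , k = M ℕ.⊔ N , λ n ≤n → subst₂ (λ s t → ℚ.∣ s ∣ ℚ.< t) (eq n) (half+half ε)
    (∣+∣-< (seq x n ℚ.- seq y n) (seq z n ℚ.- seq w n)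
      (h n (ℕ.m⊔n≤o⇒m≤o M N ≤n)) (k n (ℕ.m⊔n≤o⇒n≤o M N ≤n)))

≈ʳ-trans : ∀ {x y z} → x ≈ʳ y → y ≈ʳ z → x ≈ʳ z
≈ʳ-trans {x} {y} {z} = add-close {x} {y} {y} {z} {x} {z} (λ n → lem (seq x n) (seq y n) (seq z n))
  where
  open ℚ-Solver
  lem : ∀ x y z → (x ℚ.- y) ℚ.+ (y ℚ.- z) ≡ x ℚ.- z
  lem = solve 3 (λ x y z → (x :- y) :+ (y :- z) := x :- z) refl

+ʳ-cong : ∀ {x y z w} → x ≈ʳ y → z ≈ʳ w → x +ʳ z ≈ʳ y +ʳ w
+ʳ-cong {x} {y} {z} {w} = add-close {x} {y} {z} {w} {x +ʳ z} {y +ʳ w}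
  (λ n → lem (seq x n) (seq y n) (seq z n) (seq w n))
  where
  open ℚ-Solver
  lem : ∀ x y z w → (x ℚ.- y) ℚ.+ (z ℚ.- w) ≡ (x ℚ.+ z) ℚ.- (y ℚ.+ w)
  lem = solve 4 (λ x y z w → (x :- y) :+ (z :- w) := (x :+ z) :- (y :+ w)) refl

-ʳ-cong : ∀ {x y} → x ≈ʳ y → -ʳ x ≈ʳ -ʳ y
-ʳ-cong {x} {y} eq ε ε>0 with eq ε ε>0
... | N , h = N , λ n N≤n → subst (ℚ._< ε)
    (trans (sym (ℚ.∣-p∣≡∣p∣ (seq x n ℚ.- seq y n))) (cong ℚ.∣_∣ (lem (seq x n) (seq y n)))) (h n N≤n)
  where
  open ℚ-Solver
  lem : ∀ x y → ℚ.- (x ℚ.- y) ≡ (ℚ.- x) ℚ.- (ℚ.- y)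
  lem = solve 2 (λ x y → :- (x :- y) := (:- x) :- (:- y)) refl

-- |x| < b, with a rational margin that absorbs null sequences.
infix 4 _⊏_
_⊏_ : ℝ → ℚ → Set
x ⊏ b = ∃[ c ] (c ℚ.< b × ∃[ N ] (∀ n → N ℕ.≤ n → ℚ.∣ seq x n ∣ ℚ.< c))

⊏-resp-≈ʳ : ∀ {x y b} → x ≈ʳ y → x ⊏ b → y ⊏ b
⊏-resp-≈ʳ {x} {y} eq (c , c<b , N , h) =
  let ε , ε>0 , c+ε<b = room c<b
      M , k = eq ε ε>0
  in c ℚ.+ ε , c+ε<b , N ℕ.⊔ M , λ n ≤n →
     ∣∣-perturb (seq x n) (seq y n) (h n (ℕ.m⊔n≤o⇒m≤o N M ≤n)) (k n (ℕ.m⊔n≤o⇒n≤o N M ≤n))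

⊏⇒nonNegative : ∀ {x r} → x ⊏ r → 0ℚ ℚ.≤ r
⊏⇒nonNegative {x} (_ , lt , N , h) = ℚ.≤-trans (ℚ.0≤∣p∣ (seq x N)) (ℚ.<⇒≤ (ℚ.<-trans (h N ℕ.≤-refl) lt))

⊏-≤-trans : ∀ {x b c} → x ⊏ b → b ℚ.≤ c → x ⊏ c
⊏-≤-trans (d , d<b , h) b≤c = d , ℚ.<-≤-trans d<b b≤c , h

⊏-+ : ∀ {x y b c} → x ⊏ b → y ⊏ c → x +ʳ y ⊏ b ℚ.+ c
⊏-+ {x} {y} (b , b< , N , h) (c , c< , M , k) = b ℚ.+ c , ℚ.+-mono-< b< c< , N ℕ.⊔ M , λ n ≤n →
  ∣+∣-< (seq x n) (seq y n) (h n (ℕ.m⊔n≤o⇒m≤o N M ≤n)) (k n (ℕ.m⊔n≤o⇒n≤o N M ≤n))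

⊏-neg : ∀ {x b} → x ⊏ b → -ʳ x ⊏ b
⊏-neg {x} (c , c<b , N , h) = c , c<b , N , λ n ≤n →
    subst (ℚ._< c) (sym (ℚ.∣-p∣≡∣p∣ (seq x n))) (h n ≤n)

⊏-* : ∀ {x y b c} → x ⊏ b → y ⊏ c → x *ʳ y ⊏ b ℚ.* c
⊏-* {x} {y} (b , b< , N , h) (c , c< , M , k) =
  b ℚ.* c , *-mono-<-nonNeg (bound x N h) (bound y M k) b< c< , N ℕ.⊔ M , λ n ≤n →
    subst (ℚ._< b ℚ.* c) (sym (ℚ.∣p*q∣≡∣p∣*∣q∣ (seq x n) (seq y n)))
      (*-mono-<-nonNeg (ℚ.0≤∣p∣ (seq x n)) (ℚ.0≤∣p∣ (seq y n))
        (h n (ℕ.m⊔n≤o⇒m≤o N M ≤n)) (k n (ℕ.m⊔n≤o⇒n≤o N M ≤n)))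
  where
  bound : ∀ z {d} N → (∀ n → N ℕ.≤ n → ℚ.∣ seq z n ∣ ℚ.< d) → 0ℚ ℚ.≤ d
  bound z N h = ℚ.≤-trans (ℚ.0≤∣p∣ (seq z N)) (ℚ.<⇒≤ (h N ℕ.≤-refl))

fromℚ-⊏ : ∀ {q b} → fromℚ q ⊏ b → ℚ.∣ q ∣ ℚ.< b
fromℚ-⊏ (c , c<b , N , h) = ℚ.<-trans (h N ℕ.≤-refl) c<b

bounded : ∀ x → ∃[ b ] (x ⊏ b)
bounded x =
  let N , h = cauchy x 1ℚ 0<1
      a = ℚ.∣ seq x N ∣ ℚ.+ 1ℚ
  -- One unit (inside `a`) makes the bound at index N strict, one is the Cauchy tolerance, and one
  -- is the margin built into `_⊏_`.
  in a ℚ.+ 1ℚ ℚ.+ 1ℚ , a ℚ.+ 1ℚ , p<p+ε (a ℚ.+ 1ℚ) 0<1 , N , λ n N≤n →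
     ∣∣-perturb (seq x N) (seq x n) (p<p+ε ℚ.∣ seq x N ∣ 0<1) (h N n ℕ.≤-refl N≤n)
  where
  0<1 : 0ℚ ℚ.< 1ℚ
  0<1 = ℚ.positive⁻¹ 1ℚ

-- Additive maps ℚ → ℝ

-- An additive map on ℚ is determined by its value at 1. Applied to the composite of `σ∞` and `ι`,
-- this turns real bounds on embedded integers into rational bounds on the integers themselves.
module AdditiveMap (h : ℚ → ℝ)
  (h-+ : ∀ p q → h (p ℚ.+ q) ≈ʳ h p +ʳ h q) (h-neg : ∀ p → h (ℚ.- p) ≈ʳ -ʳ h p)
  (h-0 : h 0ℚ ≈ʳ fromℚ 0ℚ) (h-1 : h 1ℚ ≈ʳ fromℚ 1ℚ) where

  private
    Fixes : ℚ → Set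
    Fixes p = h p ≈ʳ fromℚ p

    Scales : ℚ → ℚ → Set
    Scales q p = h (p ℚ.* q) ≈ʳ fromℚ p *ʳ h q

  h-integer : ∀ z → Fixes (fromInteger z)
  h-integer = ℤ-induction (λ z → Fixes (fromInteger z)) h-0
    (λ z ih → subst Fixes (sym (fromInteger-+ (+ 1) z)) (step (fromInteger z) ih))
    (λ z ih → subst Fixes (sym (fromInteger-neg z)) (negate (fromInteger z) ih))
    where
    step : ∀ y → Fixes y → Fixes (1ℚ ℚ.+ y)
    step y ih = ≈ʳ-trans {h (1ℚ ℚ.+ y)} {h 1ℚ +ʳ h y} {fromℚ (1ℚ ℚ.+ y)} (h-+ 1ℚ y)
      (+ʳ-cong {h 1ℚ} {fromℚ 1ℚ} {h y} {fromℚ y} h-1 ih)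
    negate : ∀ y → Fixes y → Fixes (ℚ.- y)
    negate y ih = ≈ʳ-trans {h (ℚ.- y)} { -ʳ h y} {fromℚ (ℚ.- y)} (h-neg y) (-ʳ-cong {h y} {fromℚ y} ih)

  h-scale : ∀ q z → Scales q (fromInteger z)
  h-scale q = ℤ-induction (λ z → Scales q (fromInteger z)) base
    (λ z ih → subst (Scales q) (sym (fromInteger-+ (+ 1) z)) (step (fromInteger z) ih))
    (λ z ih → subst (Scales q) (sym (fromInteger-neg z)) (negate (fromInteger z) ih))
    where
    base : Scales q 0ℚ
    base = subst (λ t → h t ≈ʳ fromℚ 0ℚ *ʳ h q) (sym (ℚ.*-zeroˡ q))
      (≈ʳ-trans {h 0ℚ} {fromℚ 0ℚ} {fromℚ 0ℚ *ʳ h q} h-0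
        (≈ʳ-pointwise {fromℚ 0ℚ} {fromℚ 0ℚ *ʳ h q} λ n → sym (ℚ.*-zeroˡ (seq (h q) n))))
    dist : ∀ z q → (1ℚ ℚ.+ z) ℚ.* q ≡ q ℚ.+ z ℚ.* q
    dist z q = trans (ℚ.*-distribʳ-+ q 1ℚ z) (cong (ℚ._+ z ℚ.* q) (ℚ.*-identityˡ q))
    step : ∀ y → Scales q y → Scales q (1ℚ ℚ.+ y)
    step y ih = subst (λ t → h t ≈ʳ fromℚ (1ℚ ℚ.+ y) *ʳ h q) (sym (dist y q))
      (≈ʳ-trans {h (q ℚ.+ y ℚ.* q)} {h q +ʳ h (y ℚ.* q)} {fromℚ (1ℚ ℚ.+ y) *ʳ h q} (h-+ q (y ℚ.* q))
        (≈ʳ-trans {h q +ʳ h (y ℚ.* q)} {h q +ʳ (fromℚ y *ʳ h q)} {fromℚ (1ℚ ℚ.+ y) *ʳ h q}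
          (+ʳ-cong {h q} {h q} {h (y ℚ.* q)} {fromℚ y *ʳ h q} (≈ʳ-pointwise {h q} {h q} λ _ → refl) ih)
          (≈ʳ-pointwise {h q +ʳ (fromℚ y *ʳ h q)} {fromℚ (1ℚ ℚ.+ y) *ʳ h q} λ n →
              sym (dist y (seq (h q) n)))))
    negate : ∀ y → Scales q y → Scales q (ℚ.- y)
    negate y ih = subst (λ t → h t ≈ʳ fromℚ (ℚ.- y) *ʳ h q) (ℚ.neg-distribˡ-* y q)
      (≈ʳ-trans {h (ℚ.- (y ℚ.* q))} { -ʳ h (y ℚ.* q)} {fromℚ (ℚ.- y) *ʳ h q} (h-neg (y ℚ.* q))
        (≈ʳ-trans { -ʳ h (y ℚ.* q)} { -ʳ (fromℚ y *ʳ h q)} {fromℚ (ℚ.- y) *ʳ h q}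
          (-ʳ-cong {h (y ℚ.* q)} {fromℚ y *ʳ h q} ih)
          (≈ʳ-pointwise { -ʳ (fromℚ y *ʳ h q)} {fromℚ (ℚ.- y) *ʳ h q}
            λ n → ℚ.neg-distribˡ-* y (seq (h q) n))))

  private
    1≤fromInteger : ∀ n .{{_ : ℕ.NonZero n}} → 1ℚ ℚ.≤ fromInteger (+ n)
    1≤fromInteger (suc n) = subst₂ ℚ._≤_ (ℚ.+-identityʳ 1ℚ) (sym (fromInteger-+ (+ 1) (+ n)))
      (ℚ.+-monoʳ-≤ 1ℚ (ℚ.nonNegative⁻¹ (fromInteger (+ n)) {{ℚ.normalize-nonNeg n 1}}))

    expand : ∀ {d} → 1ℚ ℚ.≤ d → ∀ x → ℚ.∣ x ∣ ℚ.≤ ℚ.∣ d ℚ.* x ∣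
    expand {d} 1≤d x = subst₂ ℚ._≤_ (ℚ.*-identityˡ ℚ.∣ x ∣) (sym (ℚ.∣p*q∣≡∣p∣*∣q∣ d x))
      (ℚ.*-monoʳ-≤-nonNeg ℚ.∣ x ∣ {{ℚ.∣-∣-nonNeg x}} (ℚ.≤-trans 1≤d (p≤∣p∣ d)))

    factor : ∀ d x y → d ℚ.* x ℚ.- d ℚ.* y ≡ d ℚ.* (x ℚ.- y)
    factor = solve 3 (λ d x y → d :* x :- d :* y := d :* (x :- y)) refl
      where open ℚ-Solver

    -- Division by d costs no accuracy: as d ≥ 1, the error before scaling is at most the error
    -- after it, so the same N works for the same ε.
    cancel : ∀ x d q → 1ℚ ℚ.≤ d → fromℚ d *ʳ x ≈ʳ fromℚ (d ℚ.* q) → x ≈ʳ fromℚ q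
    cancel x d q 1≤d scaled ε ε>0 =
      let N , close = scaled ε ε>0
      in N , λ n N≤n → ℚ.≤-<-trans (expand 1≤d (seq x n ℚ.- q))
           (subst (λ t → ℚ.∣ t ∣ ℚ.< ε) (factor d (seq x n) q) (close n N≤n))

  h≈fromℚ : ∀ q → Fixes q
  h≈fromℚ q = cancel (h q) d q (1≤fromInteger (ℚ.↧ₙ q))
    (≈ʳ-trans {fromℚ d *ʳ h q} {h (d ℚ.* q)} {fromℚ (d ℚ.* q)}
      (≈ʳ-sym {h (d ℚ.* q)} {fromℚ d *ʳ h q} (h-scale q (ℚ.↧ q)))
      (subst Fixes (sym dq≡n) (h-integer (ℚ.↥ q))))
    where
    d = fromInteger (ℚ.↧ q)
    dq≡n : d ℚ.* q ≡ fromInteger (ℚ.↥ q)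
    dq≡n = trans (cong (d ℚ.*_) (sym (ℚ.↥p/↧p≡p q))) (/-numerator (ℚ.↥ q) (ℚ.↧ₙ q))

-- Nearest multiples

private
  -- Beyond the half-step h, moving back by the full step d = 2h gains more than δ. If the
  -- difference y - d stays positive, the gain is d > δ; if it turns negative, d - y < y - δ follows
  -- from 2y > 2h + 2δ.
  closer : ∀ y d h δ → 0ℚ ℚ.< h → 0ℚ ℚ.< δ → d ≡ h ℚ.+ h → h ℚ.+ δ ℚ.< y → δ ℚ.< d →
           ℚ.∣ y ℚ.- d ∣ ℚ.+ δ ℚ.< y
  closer y d h δ 0<h 0<δ refl large δ<d = linear-<
    (∣p∣<q {y ℚ.- d} {y ℚ.- δ} (linear-< δ<d (lem₁ y d δ))
      (linear-< (ℚ.+-mono-< (ℚ.+-mono-< large large) 0<δ) (lem₂ y h δ)))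
    (lem₃ ℚ.∣ y ℚ.- d ∣ y δ)
    where
    open ℚ-Solver
    lem₁ : ∀ y d δ → y ℚ.- δ ℚ.- (y ℚ.- d) ≡ d ℚ.- δ
    lem₁ = solve 3 (λ y d δ → y :- δ :- (y :- d) := d :- δ) refl
    lem₂ : ∀ y h δ → y ℚ.- δ ℚ.- (ℚ.- (y ℚ.- (h ℚ.+ h))) ≡
        y ℚ.+ y ℚ.+ δ ℚ.- (h ℚ.+ δ ℚ.+ (h ℚ.+ δ) ℚ.+ 0ℚ)
    lem₂ = solve 3 (λ y h δ → y :- δ :- (:- (y :- (h :+ h))) :=
        y :+ y :+ δ :- (h :+ δ :+ (h :+ δ) :+ con 0ℚ)) refl
    lem₃ : ∀ a y δ → y ℚ.- (a ℚ.+ δ) ≡ y ℚ.- δ ℚ.- a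
    lem₃ = solve 3 (λ a y δ → y :- (a :+ δ) := y :- δ :- a) refl

offset : ℝ → ℤ → ℚ → ℤ → ℝ
offset x t f i = x -ʳ fromℚ (fromInteger (t ℤ.* i)) -ʳ fromℚ f

-- Only the two neighbours m ± 1 of the minimizer m are compared with it.  The
-- slack δ makes the comparison decidable on a single rational approximation.
minimizer-⊏ : ∀ x t f m h δ b → fromInteger t ≡ h ℚ.+ h → 0ℚ ℚ.< h → 0ℚ ℚ.< δ → δ ℚ.< h ℚ.+ h →
              h ℚ.+ δ ℚ.+ δ ℚ.+ δ ℚ.< b →
              IsMinimizer (λ i → ∣ offset x t f i ∣ʳ) m → offset x t f m ⊏ b
minimizer-⊏ x t f m h δ b d≡h+h 0<h 0<δ δ<d <b min = result
  where
  d = fromInteger t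
  y = offset x t f m
  N = proj₁ (cauchy y δ 0<δ)
  stable : ∀ n → N ℕ.≤ n → ℚ.∣ seq y N ℚ.- seq y n ∣ ℚ.< δ
  stable n N≤n = proj₂ (cauchy y δ 0<δ) N n ℕ.≤-refl N≤n

  shift+ : ∀ n → seq (offset x t f (m ℤ.+ + 1)) n ≡ seq y n ℚ.- d
  shift+ n = trans (cong (λ a → seq x n ℚ.- a ℚ.- f) eq) (lem (seq x n) (fromInteger (t ℤ.* m)) d f)
    where
    open ℚ-Solver
    eq : fromInteger (t ℤ.* (m ℤ.+ + 1)) ≡ fromInteger (t ℤ.* m) ℚ.+ d
    eq = trans (cong fromInteger
        (trans (ℤ.*-distribˡ-+ t m (+ 1)) (cong (λ s → t ℤ.* m ℤ.+ s) (ℤ.*-identityʳ t))))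
           (fromInteger-+ (t ℤ.* m) t)
    lem : ∀ x a d f → x ℚ.- (a ℚ.+ d) ℚ.- f ≡ x ℚ.- a ℚ.- f ℚ.- d
    lem = solve 4 (λ x a d f → x :- (a :+ d) :- f := x :- a :- f :- d) refl

  shift- : ∀ n → seq (offset x t f (m ℤ.- + 1)) n ≡ ℚ.- (ℚ.- seq y n ℚ.- d)
  shift- n = trans (cong (λ a → seq x n ℚ.- a ℚ.- f) eq) (lem (seq x n) (fromInteger (t ℤ.* m)) d f)
    where
    open ℚ-Solver
    eqℤ : ∀ t m → t ℤ.* (m ℤ.- + 1) ≡ t ℤ.* m ℤ.+ ℤ.- t
    eqℤ = ℤ-Solver.solve 2 (λ t m → t ℤ-Solver.:* (m ℤ-Solver.:- ℤ-Solver.con (+ 1)) ℤ-Solver.:=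
                                    t ℤ-Solver.:* m ℤ-Solver.:+ ℤ-Solver.:- t) refl
    eq : fromInteger (t ℤ.* (m ℤ.- + 1)) ≡ fromInteger (t ℤ.* m) ℚ.- d
    eq = trans (cong fromInteger (eqℤ t m)) (trans (fromInteger-+ (t ℤ.* m) (ℤ.- t))
           (cong (fromInteger (t ℤ.* m) ℚ.+_) (fromInteger-neg t)))
    lem : ∀ x a d f → x ℚ.- (a ℚ.- d) ℚ.- f ≡ ℚ.- (ℚ.- (x ℚ.- a ℚ.- f) ℚ.- d)
    lem = solve 4 (λ x a d f → x :- (a :- d) :- f := :- (:- (x :- a :- f) :- d)) refl

  big : ∀ a b → h ℚ.+ δ ℚ.+ δ ℚ.≤ a → a ℚ.- b ℚ.< δ → h ℚ.+ δ ℚ.< b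
  big a b p q = linear-< (ℚ.+-mono-≤-< p q) (lem a b h δ)
    where
    open ℚ-Solver
    lem : ∀ a b h δ → b ℚ.- (h ℚ.+ δ) ≡ a ℚ.+ δ ℚ.- (h ℚ.+ δ ℚ.+ δ ℚ.+ (a ℚ.- b))
    lem = solve 4 (λ a b h δ → b :- (h :+ δ) := a :+ δ :- (h :+ δ :+ δ :+ (a :- b))) refl

  -p--q≡-[p-q] : ∀ p q → ℚ.- p ℚ.- ℚ.- q ≡ ℚ.- (p ℚ.- q)
  -p--q≡-[p-q] p q = sym (ℚ.neg-distrib-+ p (ℚ.- q))

  result : y ⊏ b
  -- The tolerance δ is spent on both sides of the threshold h + 2δ. Below it, every later term has
  -- absolute value less than h + 3δ. Above it, every later term exceeds h + δ up to sign, and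
  -- `closer` shows that the neighbour of m on that side does strictly better.
  result with ℚ.∣ seq y N ∣ ℚ.<? h ℚ.+ δ ℚ.+ δ
  ... | yes small = h ℚ.+ δ ℚ.+ δ ℚ.+ δ , <b , N , λ n N≤n →
      ∣∣-perturb (seq y N) (seq y n) small (stable n N≤n)
  ... | no large with ℚ.∣p∣≡p∨∣p∣≡-p (seq y N)
  ... | inj₁ e = ⊥-elim (min (m ℤ.+ + 1) (δ , 0<δ , N , λ n N≤n →
      subst (λ s → ℚ.∣ s ∣ ℚ.+ δ ℚ.< ℚ.∣ seq y n ∣) (sym (shift+ n))
        (ℚ.<-≤-trans (closer (seq y n) d h δ 0<h 0<δ d≡h+h (y-big n N≤n) δ<d′) (p≤∣p∣ (seq y n)))))
    where
    δ<d′ = subst (δ ℚ.<_) (sym d≡h+h) δ<d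
    y-big : ∀ n → N ℕ.≤ n → h ℚ.+ δ ℚ.< seq y n
    y-big n N≤n = big (seq y N) (seq y n) (subst (h ℚ.+ δ ℚ.+ δ ℚ.≤_) e (ℚ.≮⇒≥ large))
      (ℚ.≤-<-trans (p≤∣p∣ (seq y N ℚ.- seq y n)) (stable n N≤n))
  ... | inj₂ e = ⊥-elim (min (m ℤ.- + 1) (δ , 0<δ , N , λ n N≤n →
      subst (λ s → s ℚ.+ δ ℚ.< ℚ.∣ seq y n ∣)
        (trans (sym (ℚ.∣-p∣≡∣p∣ (ℚ.- seq y n ℚ.- d))) (cong ℚ.∣_∣ (sym (shift- n))))
        (ℚ.<-≤-trans (closer (ℚ.- seq y n) d h δ 0<h 0<δ d≡h+h (y-big n N≤n) δ<d′) (-p≤∣p∣ (seq y n)))))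
    where
    δ<d′ = subst (δ ℚ.<_) (sym d≡h+h) δ<d
    y-big : ∀ n → N ℕ.≤ n → h ℚ.+ δ ℚ.< ℚ.- seq y n
    y-big n N≤n = big (ℚ.- seq y N) (ℚ.- seq y n) (subst (h ℚ.+ δ ℚ.+ δ ℚ.≤_) e (ℚ.≮⇒≥ large))
      (subst (ℚ._< δ) (sym (-p--q≡-[p-q] (seq y N) (seq y n)))
        (ℚ.≤-<-trans (-p≤∣p∣ (seq y N ℚ.- seq y n)) (stable n N≤n)))

-- Bounded integers

∣fromInteger∣ : ∀ z → ℚ.∣ fromInteger z ∣ ≡ fromInteger (+ ℤ.∣ z ∣)
∣fromInteger∣ (+ n)    = ℚ.0≤p⇒∣p∣≡p (ℚ.nonNegative⁻¹ (fromInteger (+ n)) {{ℚ.normalize-nonNeg n 1}})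
∣fromInteger∣ -[1+ n ] = trans (ℚ.∣-p∣≡∣p∣ (fromInteger (+ suc n))) (∣fromInteger∣ (+ suc n))

-- Denominators are at least 1, so the numerator of b is already an integer upper bound, crude but
-- sufficient for finiteness.
fromInteger-bound : ∀ {z b} → ℚ.∣ fromInteger z ∣ ℚ.< b → ℤ.∣ z ∣ ≤ ℤ.∣ ℚ.↥ b ∣
fromInteger-bound {z} {b@record{}} h =
    ℕ.≤-trans (ℕ.m≤m*n n (ℚ.↧ₙ b)) (ℤ.drop‿+≤+ (ℤ.≤-trans (ℤ.<⇒≤ below) (i≤∣i∣ (ℚ.↥ b))))
  where
  n = ℤ.∣ z ∣
  i≤∣i∣ : ∀ i → i ℤ.≤ + ℤ.∣ i ∣
  i≤∣i∣ (+ n)    = ℤ.≤-refl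
  i≤∣i∣ -[1+ n ] = ℤ.-≤+
  unnormalised : ℚᵘ.mkℚᵘ (+ n) 0 ℚᵘ.< ℚ.toℚᵘ b
  unnormalised = ℚᵘ.<-respˡ-≃ (toℚᵘ-fromInteger (+ n))
      (ℚ.toℚᵘ-mono-< (subst (ℚ._< b) (∣fromInteger∣ z) h))
  below : + (n ℕ.* ℚ.↧ₙ b) ℤ.< ℚ.↥ b
  below = subst₂ ℤ._<_ (sym (ℤ.pos-* n (ℚ.↧ₙ b))) (ℤ.*-identityʳ (ℚ.↥ b)) (ℚᵘ.drop-*<* unnormalised)

private
  module Shift (L : ℕ) where
    0≤z+L : ∀ z → ℤ.∣ z ∣ ≤ L → + 0 ℤ.≤ z ℤ.+ + L
    0≤z+L (+ n)    _ = ℤ.+≤+ ℕ.z≤n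
    0≤z+L -[1+ n ] h = subst (+ 0 ℤ.≤_) (sym (ℤ.⊖-≥ h)) (ℤ.+≤+ ℕ.z≤n)

    code : ∀ z → ℤ.∣ z ∣ ≤ L → Fin (suc (L ℕ.+ L))
    code z h = fromℕ< (ℕ.s≤s (ℕ.≤-trans (ℤ.∣i+j∣≤∣i∣+∣j∣ z (+ L)) (ℕ.+-monoˡ-≤ L h)))

    code-injective : ∀ z w h k → code z h ≡ code w k → z ≡ w
    code-injective z w h k eq = ℤ-Group.∙-cancelʳ (+ L) z w (begin
      z ℤ.+ + L             ≡⟨ ℤ.0≤i⇒+∣i∣≡i (0≤z+L z h) ⟨
      + ℤ.∣ z ℤ.+ + L ∣     ≡⟨ cong +_ (Fin.fromℕ<-injective _ _ _ _ eq) ⟩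
      + ℤ.∣ w ℤ.+ + L ∣     ≡⟨ ℤ.0≤i⇒+∣i∣≡i (0≤z+L w k) ⟩
      w ℤ.+ + L             ∎)
      where open ≡-Reasoning

bounded-pairs-repeat : ∀ L M (f g : ℕ → ℤ) → (∀ j → ℤ.∣ f j ∣ ≤ L) → (∀ j → ℤ.∣ g j ∣ ≤ M) →
                       ∃₂ λ i j → i < j × f i ≡ f j × g i ≡ g j
bounded-pairs-repeat L M f g hf hg =
  let i , j , i<j , eq = Fin.pigeonhole (ℕ.n<1+n _) pair
      eqf , eqg = Fin.combine-injective (codeᶠ i) (codeᵍ i) (codeᶠ j) (codeᵍ j) eq
  in toℕ i , toℕ j , i<j ,
     Shift.code-injective L (f (toℕ i)) (f (toℕ j)) (hf (toℕ i)) (hf (toℕ j)) eqf ,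
     Shift.code-injective M (g (toℕ i)) (g (toℕ j)) (hg (toℕ i)) (hg (toℕ j)) eqg
  where
  N = suc (L ℕ.+ L) ℕ.* suc (M ℕ.+ M)
  codeᶠ : Fin (suc N) → Fin (suc (L ℕ.+ L))
  codeᶠ i = Shift.code L (f (toℕ i)) (hf (toℕ i))
  codeᵍ : Fin (suc N) → Fin (suc (M ℕ.+ M))
  codeᵍ i = Shift.code M (g (toℕ i)) (hg (toℕ i))
  pair : Fin (suc N) → Fin N
  pair i = combine (codeᶠ i) (codeᵍ i)

-- Quadratic forms over the field

module Field {κ ℓ} (K : QuadraticField κ ℓ) where
  open QuadraticField K hiding (zero; refl; sym; trans)
  private
    module K = QuadraticField K
    module ι = IsRingHomomorphism ι-isRingHomomorphism
  open import Relation.Binary.Reasoning.Setoid K.setoid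

  ιᶻ : ℤ → Carrier
  ιᶻ z = ι (fromInteger z)

  ι-cong : ∀ {p q} → p ≡ q → ι p ≈ ι q
  ι-cong = ι.⟦⟧-cong

  ιᶻ-+ : ∀ i j → ιᶻ (i ℤ.+ j) ≈ ιᶻ i + ιᶻ j
  ιᶻ-+ i j = K.trans (ι-cong (fromInteger-+ i j)) (ι.+-homo (fromInteger i) (fromInteger j))

  ιᶻ-* : ∀ i j → ιᶻ (i ℤ.* j) ≈ ιᶻ i * ιᶻ j
  ιᶻ-* i j = K.trans (ι-cong (fromInteger-* i j)) (ι.*-homo (fromInteger i) (fromInteger j))

  ιᶻ-neg : ∀ i → ιᶻ (ℤ.- i) ≈ - ιᶻ i
  ιᶻ-neg i = K.trans (ι-cong (fromInteger-neg i)) (ι.-‿homo (fromInteger i))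

  private
    ιᶻ-≟ : ∀ i j → Maybe (ιᶻ i ≈ ιᶻ j)
    ιᶻ-≟ i j with i ℤ.≟ j
    ... | yes refl = just K.refl
    ... | no _     = nothing

    ιᶻ-morphism : ℤ.+-*-rawRing -Raw-AlmostCommutative⟶ fromCommutativeRing commutativeRing
    ιᶻ-morphism = record
      { ⟦_⟧ = ιᶻ ; +-homo = ιᶻ-+ ; *-homo = ιᶻ-* ; -‿homo = ιᶻ-neg
      ; 0-homo = ι.0#-homo ; 1-homo = ι.1#-homo }

  module K-Solver = Algebra.Solver.Ring
    ℤ.+-*-rawRing (fromCommutativeRing commutativeRing) ιᶻ-morphism ιᶻ-≟

  private
    one two : Carrier
    one = ιᶻ (+ 1)
    two = ιᶻ (+ 2)

  x-y≈0⇒x≈y : ∀ {x y} → x - y ≈ 0# → x ≈ y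
  x-y≈0⇒x≈y {x} {y} h = begin
    x            ≈⟨ solve 2 (λ x y → x := (x :- y) :+ y) K.refl x y ⟩
    (x - y) + y  ≈⟨ +-congʳ h ⟩
    0# + y       ≈⟨ +-identityˡ y ⟩
    y            ∎
    where open K-Solver

  x≈y⇒x-y≈0 : ∀ {x y} → x ≈ y → x - y ≈ 0#
  x≈y⇒x-y≈0 {x} {y} h = K.trans (+-congʳ h) (-‿inverseʳ y)

  -- Ideal membership as a certificate: p and q are the cofactors expressing r through the vanishing
  -- quantities u and v, and the identity itself is left to the ring solver.
  vanish : ∀ {r u v} p q → r ≈ p * u + q * v → u ≈ 0# → v ≈ 0# → r ≈ 0#
  vanish {r} {u} {v} p q eq u≈0 v≈0 = begin
    r                ≈⟨ eq ⟩
    p * u + q * v    ≈⟨ +-cong (*-congˡ u≈0) (*-congˡ v≈0) ⟩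
    p * 0# + q * 0#  ≈⟨ +-cong (zeroʳ p) (zeroʳ q) ⟩
    0# + 0#          ≈⟨ +-identityˡ 0# ⟩
    0#               ∎

  quadratic : Carrier → Carrier → Carrier → Carrier → Carrier
  quadratic a b c x = a * (x * x) + b * x + c

  derivative : Carrier → Carrier → Carrier → Carrier
  derivative a b x = two * a * x + b

  -- The substitution x = 1/(y + q).
  module Substitution {a b c x y q d} (inv : x * (y + q) ≈ 1#)
    (root : quadratic a b c x ≈ 0#) (deriv : derivative a b x ≈ d) where
    private
      u≈0 : one - x * (y + q) ≈ 0#
      u≈0 = x≈y⇒x-y≈0 (K.trans ι.1#-homo (K.sym inv))

    -- Eliminate b through b = d - 2ax. The formula is free of b and c, so the recursion for the
    -- bounds closes up on leading coefficients alone.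
    leading : c ≈ a * (x * x) - d * x
    leading = x-y≈0⇒x≈y (vanish one (- x) (solve 5 (λ a b c x d → c :- (a :* (x :* x) :- d :* x) :=
        con (+ 1) :* (a :* (x :* x) :+ b :* x :+ c) :+ (:- x) :* (con (+ 2) :* a :* x :+ b :- d))
            K.refl a b c x d)
        root (x≈y⇒x-y≈0 deriv))
      where open K-Solver

    root′ : quadratic c (b + two * q * c) (a + q * b + q * q * c) y ≈ 0#
    -- Multiplying the equation of x by (y + q)² gives a w² + b w (y + q) + c (y + q)² with w = x (y
    -- + q). The second cofactor replaces w by 1.
    root′ = vanish ((y + q) * (y + q)) (a * (one + x * (y + q)) + b * (y + q))
        (solve 6 (λ a b c x y q →
          c :* (y :* y) :+ (b :+ con (+ 2) :* q :* c) :* y :+ (a :+ q :* b :+ q :* q :* c) :=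
          (y :+ q) :* (y :+ q) :* (a :* (x :* x) :+ b :* x :+ c) :+
          (a :* (con (+ 1) :+ x :* (y :+ q)) :+ b :* (y :+ q)) :* (con (+ 1) :- x :* (y :+ q)))
              K.refl a b c x y q)
        root u≈0
      where open K-Solver

    -- The matrix of y ↦ 1/(y + q) has determinant -1: the discriminant is preserved and its chosen
    -- square root changes sign.
    derivative′ : derivative c (b + two * q * c) y ≈ - d
    derivative′ = K.trans (x-y≈0⇒x≈y (vanish (two * (y + q)) (two * a * x + two * b)
        (solve 6 (λ a b c x y q →
          con (+ 2) :* c :* y :+ (b :+ con (+ 2) :* q :* c) :- (:- (con (+ 2) :* a :* x :+ b)) :=
          con (+ 2) :* (y :+ q) :* (a :* (x :* x) :+ b :* x :+ c) :+
          (con (+ 2) :* a :* x :+ con (+ 2) :* b) :* (con (+ 1) :- x :* (y :+ q))) K.refl a b c x y q)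
        root u≈0)) (-‿cong deriv)
      where open K-Solver

  ι-inverse : ∀ {q} → ¬ (q ≡ 0ℚ) → ∃[ r ] (ι r * ι q ≈ 1#)
  ι-inverse {q} q≢0 = ℚ.1/ q , (begin
    ι (ℚ.1/ q) * ι q   ≈⟨ ι.*-homo (ℚ.1/ q) q ⟨
    ι (ℚ.1/ q ℚ.* q)   ≈⟨ ι-cong (ℚ.*-inverseˡ q) ⟩
    ι 1ℚ               ≈⟨ ι.1#-homo ⟩
    1#                 ∎)
    where instance _ = ℚ.≢-nonZero q≢0

  ι-cancel : ∀ {q x y} → ¬ (q ≡ 0ℚ) → ι q * x ≈ y → ∃[ r ] (x ≈ ι r * y)
  ι-cancel {q} {x} {y} q≢0 h with ι-inverse q≢0
  ... | r , inv = r , (begin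
    x                 ≈⟨ *-identityˡ x ⟨
    1# * x            ≈⟨ *-congʳ inv ⟨
    ι r * ι q * x     ≈⟨ *-assoc (ι r) (ι q) x ⟩
    ι r * (ι q * x)   ≈⟨ *-congˡ h ⟩
    ι r * y           ∎)

  rational-resp : ∀ {x y} → x ≈ y → IsRational x → IsRational y
  rational-resp x≈y (q , h) = q , K.trans (K.sym x≈y) h

  rational-quotient : ∀ {p q x} → ¬ (q ≡ 0ℚ) → ι q * x ≈ ι p → IsRational x
  rational-quotient {p} q≢0 h with ι-cancel q≢0 h
  ... | r , eq = r ℚ.* p , K.trans eq (K.sym (ι.*-homo r p))

  rational-inverse : ∀ {x y} → x * y ≈ 1# → IsRational y → IsRational x
  rational-inverse {x} {y} inv (q , y≈ιq) = rational-quotient {1ℚ} q≢0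
    (K.trans (*-comm (ι q) x) (K.trans (*-congˡ (K.sym y≈ιq)) (K.trans inv (K.sym ι.1#-homo))))
    where
    q≢0 : ¬ (q ≡ 0ℚ)
    q≢0 refl = 1≉0 (K.trans (K.sym inv) (K.trans (*-congˡ (K.trans y≈ιq ι.0#-homo)) (zeroʳ x)))

  rational-+ : ∀ {x q} → IsRational (x - ι q) → IsRational x
  rational-+ {x} {q} (r , h) = r ℚ.+ q , (begin
    x                ≈⟨ solve 2 (λ x y → x := (x :- y) :+ y) K.refl x (ι q) ⟩
    x - ι q + ι q    ≈⟨ +-congʳ h ⟩
    ι r + ι q        ≈⟨ ι.+-homo r q ⟨
    ι (r ℚ.+ q)      ∎)
    where open K-Solver

  -- d = 2ax + b is a square root of the discriminant; a step only changes its sign.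
  record Form (x d : Carrier) : Set ℓ where
    field
      a b c : ℤ
      root  : quadratic (ιᶻ a) (ιᶻ b) (ιᶻ c) x ≈ 0#
      deriv : derivative (ιᶻ a) (ιᶻ b) x ≈ d

  open Form public

  deriv-irrational : ∀ {x d} (F : Form x d) → ¬ IsRational x → ¬ (a F ≡ + 0) → ¬ IsRational d
  deriv-irrational {x} {d} F irr a≢0 (r , d≈ιr) = irr (rational-quotient {r ℚ.- fromInteger (b F)}
    {fromInteger (+ 2 ℤ.* a F)} {x} (fromInteger-2*≢0 a≢0) (begin
      ιᶻ (+ 2 ℤ.* a F) * x
        ≈⟨ *-congʳ (ιᶻ-* (+ 2) (a F)) ⟩
      two * ιᶻ (a F) * x
        ≈⟨ solve 2 (λ s b → s := (s :+ b) :- b) K.refl (two * ιᶻ (a F) * x) (ιᶻ (b F)) ⟩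
      derivative (ιᶻ (a F)) (ιᶻ (b F)) x - ιᶻ (b F)
        ≈⟨ +-cong (K.trans (deriv F) d≈ιr) (K.sym (ι.-‿homo (fromInteger (b F)))) ⟩
      ι r + ι (ℚ.- fromInteger (b F))
        ≈⟨ ι.+-homo r (ℚ.- fromInteger (b F)) ⟨
      ι (r ℚ.- fromInteger (b F)) ∎))
    where
    open K-Solver

  leading≢0 : ∀ {x d} (F : Form x d) → ¬ IsRational d → ¬ (a F ≡ + 0)
  leading≢0 {x} {d} F irr a≡0 = irr (fromInteger (b F) , (begin
    d                                   ≈⟨ deriv F ⟨
    two * ιᶻ (a F) * x + ιᶻ (b F)       ≈⟨ +-congʳ
        (*-congʳ (*-congˡ (K.trans (ι-cong (cong fromInteger a≡0)) ι.0#-homo))) ⟩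
    two * 0# * x + ιᶻ (b F)             ≈⟨ +-congʳ (K.trans (*-congʳ (zeroʳ two)) (zeroˡ x)) ⟩
    0# + ιᶻ (b F)                       ≈⟨ +-identityˡ (ιᶻ (b F)) ⟩
    ιᶻ (b F)                            ∎))

  form-determines : ∀ {x y d} (F : Form x d) (G : Form y d) → ¬ IsRational d →
                    a F ≡ a G → b F ≡ b G → x ≈ y
  form-determines {x} {y} {d} F G irr a≡ b≡ = x-y≈0⇒x≈y
    (K.trans (proj₂ cancelled) (zeroʳ (ι (proj₁ cancelled))))
    where
    open K-Solver
    A = ιᶻ (a F)
    derivG : derivative A (ιᶻ (b F)) y ≈ d
    derivG = subst₂ (λ s t → derivative (ιᶻ s) (ιᶻ t) y ≈ d) (sym a≡) (sym b≡) (deriv G)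
    scaled : ιᶻ (+ 2 ℤ.* a F) * (x - y) ≈ 0#
    scaled = begin
      ιᶻ (+ 2 ℤ.* a F) * (x - y) ≈⟨ *-congʳ (ιᶻ-* (+ 2) (a F)) ⟩
      two * A * (x - y)
        ≈⟨ solve 5 (λ t A b x y → t :* A :* (x :- y) := (t :* A :* x :+ b) :- (t :* A :* y :+ b))
            K.refl two A (ιᶻ (b F)) x y ⟩
      derivative A (ιᶻ (b F)) x - derivative A (ιᶻ (b F)) y
        ≈⟨ x≈y⇒x-y≈0 (K.trans (deriv F) (K.sym derivG)) ⟩
      0# ∎
    cancelled : ∃[ r ] (x - y ≈ ι r * 0#)
    cancelled = ι-cancel (fromInteger-2*≢0 (leading≢0 F irr)) scaled

  -- The coefficients are the 2 × 2 minors of the coordinates of 1, x, x².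
  minimal-form : ∀ x → ¬ IsRational x → ∃[ d ] ∃[ F ] (¬ (a {x} {d} F ≡ + 0))
  minimal-form x irr with spanning 1# | spanning x | spanning (x * x)
  ... | p₀ , q₀ , h₀ | p₁ , q₁ , h₁ | p₂ , q₂ , h₂ = _ , F , nonzero
    where
    open K-Solver
    α β γ : ℚ
    α = p₀ ℚ.* q₁ ℚ.- p₁ ℚ.* q₀
    β = p₂ ℚ.* q₀ ℚ.- p₀ ℚ.* q₂
    γ = p₁ ℚ.* q₂ ℚ.- p₂ ℚ.* q₁

    minor : ∀ p q r s → ι (p ℚ.* q ℚ.- r ℚ.* s) ≈ ι p * ι q - ι r * ι s
    minor p q r s = K.trans (ι.+-homo (p ℚ.* q) (ℚ.- (r ℚ.* s)))
      (+-cong (ι.*-homo p q) (K.trans (ι.-‿homo (r ℚ.* s)) (-‿cong (ι.*-homo r s))))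

    -- The left side expands the 3 × 3 determinant with columns (1, x, x²), (p₀, p₁, p₂) and (q₀,
    -- q₁, q₂). It vanishes because the first column is e₁ times the second plus e₂ times the third.
    rootℚ : quadratic (ι α) (ι β) (ι γ) x ≈ 0#
    rootℚ = begin
      ι α * (x * x) + ι β * x + ι γ
        ≈⟨ +-congˡ (K.sym (*-identityʳ (ι γ))) ⟩
      ι α * (x * x) + ι β * x + ι γ * 1#
        ≈⟨ +-cong (+-cong (*-cong (minor p₀ q₁ p₁ q₀) h₂) (*-cong (minor p₂ q₀ p₀ q₂) h₁))
                  (*-cong (minor p₁ q₂ p₂ q₁) h₀) ⟩
      _ ≈⟨ solve 8 (λ p₀ q₀ p₁ q₁ p₂ q₂ e f →
             (p₀ :* q₁ :- p₁ :* q₀) :* (p₂ :* e :+ q₂ :* f) :+ (p₂ :* q₀ :- p₀ :* q₂) :*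
                 (p₁ :* e :+ q₁ :* f)
               :+ (p₁ :* q₂ :- p₂ :* q₁) :* (p₀ :* e :+ q₀ :* f) := con (+ 0)) K.refl
             (ι p₀) (ι q₀) (ι p₁) (ι q₁) (ι p₂) (ι q₂) e₁ e₂ ⟩
      ιᶻ (+ 0) ≈⟨ ι.0#-homo ⟩
      0# ∎

    proportional : ∀ e f r s u v → 1# ≈ ι r * e + ι u * f → x ≈ ι s * e + ι v * f → r ℚ.* v ≡ s ℚ.* u →
                   ¬ (r ≡ 0ℚ) → IsRational x
    proportional e f r s u v h k eq r≢0 = rational-quotient {s} r≢0 (begin
      ι r * x                              ≈⟨ *-congˡ k ⟩
      ι r * (ι s * e + ι v * f)            ≈⟨ solve 5
          (λ r s v e f → r :* (s :* e :+ v :* f) := s :* (r :* e) :+ r :* v :* f) K.refl (ι r) (ι s)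
              (ι v) e f ⟩
      ι s * (ι r * e) + ι r * ι v * f      ≈⟨ +-congˡ
          (*-congʳ (K.trans (K.sym (ι.*-homo r v)) (K.trans (ι-cong eq) (ι.*-homo s u)))) ⟩
      ι s * (ι r * e) + ι s * ι u * f      ≈⟨ solve 5
          (λ r s u e f → s :* (r :* e) :+ s :* u :* f := s :* (r :* e :+ u :* f)) K.refl (ι r) (ι s)
              (ι u) e f ⟩
      ι s * (ι r * e + ι u * f)            ≈⟨ *-congˡ h ⟨
      ι s * 1#                             ≈⟨ *-identityʳ (ι s) ⟩
      ι s                                  ∎)

    -- α is the determinant of the coordinates of 1 and x. If it vanished, x would be a rational
    -- multiple of 1; the coordinate of 1 to divide by exists because 1 is nonzero. Swapping the
    -- basis vectors lets `proportional` handle both choices.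
    α≢0 : ¬ (α ≡ 0ℚ)
    α≢0 α≡0 with p₀ ℚ.≟ 0ℚ | q₀ ℚ.≟ 0ℚ
    ... | no p₀≢0 | _ = irr (proportional e₁ e₂ p₀ p₁ q₀ q₁ h₀ h₁ minors p₀≢0)
      where
      minors : p₀ ℚ.* q₁ ≡ p₁ ℚ.* q₀
      minors = ℚ-Group.x∙y⁻¹≈ε⇒x≈y (p₀ ℚ.* q₁) (p₁ ℚ.* q₀) α≡0
    ... | yes _ | no q₀≢0 = irr
        (proportional e₂ e₁ q₀ q₁ p₀ p₁ (K.trans h₀ (+-comm _ _)) (K.trans h₁ (+-comm _ _)) minors q₀≢0)
      where
      minors : q₀ ℚ.* p₁ ≡ q₁ ℚ.* p₀
      minors = trans (ℚ.*-comm q₀ p₁)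
          (trans (sym (ℚ-Group.x∙y⁻¹≈ε⇒x≈y (p₀ ℚ.* q₁) (p₁ ℚ.* q₀) α≡0)) (ℚ.*-comm p₀ q₁))
    ... | yes refl | yes refl = 1≉0 (K.trans h₀ (K.trans (+-cong
        (K.trans (*-congʳ ι.0#-homo) (zeroˡ e₁)) (K.trans (*-congʳ ι.0#-homo) (zeroˡ e₂)))
            (+-identityˡ 0#)))

    numerator : ∀ q → fromInteger (ℚ.↥ q) ≡ fromInteger (ℚ.↧ q) ℚ.* q
    numerator q = sym (trans (cong (fromInteger (ℚ.↧ q) ℚ.*_) (sym (ℚ.↥p/↧p≡p q)))
        (/-numerator (ℚ.↥ q) (ℚ.↧ₙ q)))

    clear : ∀ p q r → ιᶻ (ℚ.↥ p ℤ.* (ℚ.↧ q ℤ.* ℚ.↧ r)) ≈ ιᶻ (ℚ.↧ p) * ιᶻ (ℚ.↧ q) * ιᶻ (ℚ.↧ r) * ι p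
    clear p q r = begin
      ιᶻ (ℚ.↥ p ℤ.* (ℚ.↧ q ℤ.* ℚ.↧ r))
        ≈⟨ K.trans (ιᶻ-* (ℚ.↥ p) (ℚ.↧ q ℤ.* ℚ.↧ r)) (*-congˡ (ιᶻ-* (ℚ.↧ q) (ℚ.↧ r))) ⟩
      ιᶻ (ℚ.↥ p) * (ιᶻ (ℚ.↧ q) * ιᶻ (ℚ.↧ r))
        ≈⟨ *-congʳ (K.trans (ι-cong (numerator p)) (ι.*-homo (fromInteger (ℚ.↧ p)) p)) ⟩
      ιᶻ (ℚ.↧ p) * ι p * (ιᶻ (ℚ.↧ q) * ιᶻ (ℚ.↧ r))
        ≈⟨ solve 4 (λ d e f p → d :* p :* (e :* f) := d :* e :* f :* p) K.refl (ιᶻ (ℚ.↧ p))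
            (ιᶻ (ℚ.↧ q)) (ιᶻ (ℚ.↧ r)) (ι p) ⟩
      ιᶻ (ℚ.↧ p) * ιᶻ (ℚ.↧ q) * ιᶻ (ℚ.↧ r) * ι p ∎

    F : Form x _
    F = record
      { a = ℚ.↥ α ℤ.* (ℚ.↧ β ℤ.* ℚ.↧ γ)
      ; b = ℚ.↥ β ℤ.* (ℚ.↧ γ ℤ.* ℚ.↧ α)
      ; c = ℚ.↥ γ ℤ.* (ℚ.↧ α ℤ.* ℚ.↧ β)
      ; root = begin
          _ ≈⟨ +-cong (+-cong (*-congʳ (clear α β γ)) (*-congʳ (clear β γ α))) (clear γ α β) ⟩
          _ ≈⟨ solve 7 (λ A B C d e f x →
                 d :* e :* f :* A :* (x :* x) :+ e :* f :* d :* B :* x :+ f :* d :* e :* C :=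
                 d :* e :* f :* (A :* (x :* x) :+ B :* x :+ C)) K.refl
                 (ι α) (ι β) (ι γ) (ιᶻ (ℚ.↧ α)) (ιᶻ (ℚ.↧ β)) (ιᶻ (ℚ.↧ γ)) x ⟩
          ιᶻ (ℚ.↧ α) * ιᶻ (ℚ.↧ β) * ιᶻ (ℚ.↧ γ) * quadratic (ι α) (ι β) (ι γ) x ≈⟨ *-congˡ rootℚ ⟩
          ιᶻ (ℚ.↧ α) * ιᶻ (ℚ.↧ β) * ιᶻ (ℚ.↧ γ) * 0# ≈⟨ zeroʳ _ ⟩
          0# ∎
      ; deriv = K.refl
      }

    nonzero : ¬ (ℚ.↥ α ℤ.* (ℚ.↧ β ℤ.* ℚ.↧ γ) ≡ + 0)
    nonzero eq with ℤ.i*j≡0⇒i≡0∨j≡0 (ℚ.↥ α) eq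
    ... | inj₁ ↥α≡0 = α≢0 (ℚ.↥p≡0⇒p≡0 α ↥α≡0)
    ... | inj₂ eq′ with ℤ.i*j≡0⇒i≡0∨j≡0 (ℚ.↧ β) {ℚ.↧ γ} eq′
    ... | inj₁ ()
    ... | inj₂ ()

-- Dyadic rationals

Dyadic : ℚ → Set
Dyadic q = ∃₂ λ k z → fromInteger (2^ k) ℚ.* q ≡ fromInteger z

dyadic-b : ∀ {q} b c → Dyadic q → Dyadic (fromInteger b ℚ.+ fromInteger (+ 2) ℚ.* q ℚ.* fromInteger c)
dyadic-b {q} b c (k , n , eq) = k , 2^ k ℤ.* b ℤ.+ + 2 ℤ.* n ℤ.* c , (begin
  F (2^ k) ℚ.* (F b ℚ.+ F (+ 2) ℚ.* q ℚ.* F c)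
    ≡⟨ solve 5 (λ P b t q c → P :* (b :+ t :* q :* c) := P :* b :+ t :* (P :* q) :* c) refl
         (F (2^ k)) (F b) (F (+ 2)) q (F c) ⟩
  F (2^ k) ℚ.* F b ℚ.+ F (+ 2) ℚ.* (F (2^ k) ℚ.* q) ℚ.* F c
    ≡⟨ cong (λ t → F (2^ k) ℚ.* F b ℚ.+ F (+ 2) ℚ.* t ℚ.* F c) eq ⟩
  F (2^ k) ℚ.* F b ℚ.+ F (+ 2) ℚ.* F n ℚ.* F c
    ≡⟨ cong₂ ℚ._+_ (fromInteger-* (2^ k) b)
        (trans (fromInteger-* (+ 2 ℤ.* n) c) (cong (ℚ._* F c) (fromInteger-* (+ 2) n))) ⟨
  F (2^ k ℤ.* b) ℚ.+ F (+ 2 ℤ.* n ℤ.* c)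
    ≡⟨ fromInteger-+ (2^ k ℤ.* b) (+ 2 ℤ.* n ℤ.* c) ⟨
  F (2^ k ℤ.* b ℤ.+ + 2 ℤ.* n ℤ.* c) ∎)
  where
  open ≡-Reasoning
  open ℚ-Solver
  F = fromInteger

dyadic-c : ∀ {q} a b c → Dyadic q →
    Dyadic (fromInteger a ℚ.+ q ℚ.* fromInteger b ℚ.+ q ℚ.* q ℚ.* fromInteger c)
dyadic-c {q} a b c (k , n , eq) = k ℕ.+ k ,
    2^ k ℤ.* 2^ k ℤ.* a ℤ.+ 2^ k ℤ.* n ℤ.* b ℤ.+ n ℤ.* n ℤ.* c , (begin
  F (2^ (k ℕ.+ k)) ℚ.* (F a ℚ.+ q ℚ.* F b ℚ.+ q ℚ.* q ℚ.* F c)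
    ≡⟨ cong (ℚ._* (F a ℚ.+ q ℚ.* F b ℚ.+ q ℚ.* q ℚ.* F c))
        (trans (cong F (2^-+ k k)) (fromInteger-* (2^ k) (2^ k))) ⟩
  P ℚ.* P ℚ.* (F a ℚ.+ q ℚ.* F b ℚ.+ q ℚ.* q ℚ.* F c)
    ≡⟨ solve 5 (λ P a b c q → P :* P :* (a :+ q :* b :+ q :* q :* c) :=
                              P :* P :* a :+ P :* (P :* q) :* b :+ (P :* q) :* (P :* q) :* c) refl P
                                  (F a) (F b) (F c) q ⟩
  P ℚ.* P ℚ.* F a ℚ.+ P ℚ.* (P ℚ.* q) ℚ.* F b ℚ.+ (P ℚ.* q) ℚ.* (P ℚ.* q) ℚ.* F c
    ≡⟨ cong (λ t → P ℚ.* P ℚ.* F a ℚ.+ P ℚ.* t ℚ.* F b ℚ.+ t ℚ.* t ℚ.* F c) eq ⟩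
  P ℚ.* P ℚ.* F a ℚ.+ P ℚ.* F n ℚ.* F b ℚ.+ F n ℚ.* F n ℚ.* F c
    ≡⟨ cong₂ ℚ._+_ (cong₂ ℚ._+_ (F-*-* (2^ k) (2^ k) a) (F-*-* (2^ k) n b)) (F-*-* n n c) ⟨
  F (2^ k ℤ.* 2^ k ℤ.* a) ℚ.+ F (2^ k ℤ.* n ℤ.* b) ℚ.+ F (n ℤ.* n ℤ.* c)
    ≡⟨ trans (fromInteger-+ (2^ k ℤ.* 2^ k ℤ.* a ℤ.+ 2^ k ℤ.* n ℤ.* b) (n ℤ.* n ℤ.* c))
         (cong (ℚ._+ F (n ℤ.* n ℤ.* c)) (fromInteger-+ (2^ k ℤ.* 2^ k ℤ.* a) (2^ k ℤ.* n ℤ.* b))) ⟨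
  F (2^ k ℤ.* 2^ k ℤ.* a ℤ.+ 2^ k ℤ.* n ℤ.* b ℤ.+ n ℤ.* n ℤ.* c) ∎)
  where
  open ≡-Reasoning
  open ℚ-Solver
  F = fromInteger
  P = F (2^ k)
  F-*-* : ∀ i j l → F (i ℤ.* j ℤ.* l) ≡ F i ℚ.* F j ℚ.* F l
  F-*-* i j l = trans (fromInteger-* (i ℤ.* j) l) (cong (ℚ._* F l) (fromInteger-* i j))

-- One step of the algorithm

module Embedded {κ ℓ} (K : QuadraticField κ ℓ)
  (σ∞ : QuadraticField.Carrier K → ℝ)
  (σ∞-mono : IsRingMonomorphism (QuadraticField.rawRing K) ℝ-rawRing σ∞)
  (σ₂ : QuadraticField.Carrier K → ℚ₂)
  (σ₂-mono : IsRingMonomorphism (QuadraticField.rawRing K) ℚ₂-rawRing σ₂) where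

  open QuadraticField K hiding (zero; refl; sym; trans)
  open Field K
  private
    module K = QuadraticField K
    module ι = IsRingHomomorphism ι-isRingHomomorphism
    module at∞ = IsRingMonomorphism σ∞-mono
    module at₂ = IsRingMonomorphism σ₂-mono
  open import Relation.Binary.Reasoning.Setoid K.setoid
  open import Algebra.Properties.Ring K.ring using (-‿involutive)

  σ∞ι≈fromℚ : ∀ q → σ∞ (ι q) ≈ʳ fromℚ q
  σ∞ι≈fromℚ = AdditiveMap.h≈fromℚ (λ q → σ∞ (ι q))
    (λ p q → tr (ι (p ℚ.+ q)) (σ∞ (ι p) +ʳ σ∞ (ι q)) (ι.+-homo p q) (at∞.+-homo (ι p) (ι q)))
    (λ p → tr (ι (ℚ.- p)) (-ʳ σ∞ (ι p)) (ι.-‿homo p) (at∞.-‿homo (ι p)))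
    (tr (ι 0ℚ) (fromℚ 0ℚ) ι.0#-homo at∞.0#-homo)
    (tr (ι 1ℚ) (fromℚ 1ℚ) ι.1#-homo at∞.1#-homo)
    where
    tr : ∀ x {y} r → x ≈ y → σ∞ y ≈ʳ r → σ∞ x ≈ʳ r
    tr x {y} r p q = ≈ʳ-trans {σ∞ x} {σ∞ y} {r} (at∞.⟦⟧-cong p) q

  infix 4 _⊏∞_
  _⊏∞_ : Carrier → ℚ → Set
  x ⊏∞ r = σ∞ x ⊏ r

  ⊏∞-resp : ∀ {x y r} → x ≈ y → x ⊏∞ r → y ⊏∞ r
  ⊏∞-resp {x} {y} eq = ⊏-resp-≈ʳ {σ∞ x} {σ∞ y} (at∞.⟦⟧-cong eq)

  ⊏∞-+ : ∀ {x y r s} → x ⊏∞ r → y ⊏∞ s → x + y ⊏∞ r ℚ.+ s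
  ⊏∞-+ {x} {y} h k = ⊏-resp-≈ʳ {σ∞ x +ʳ σ∞ y} {σ∞ (x + y)}
    (≈ʳ-sym {σ∞ (x + y)} {σ∞ x +ʳ σ∞ y} (at∞.+-homo x y)) (⊏-+ {σ∞ x} {σ∞ y} h k)

  ⊏∞-* : ∀ {x y r s} → x ⊏∞ r → y ⊏∞ s → x * y ⊏∞ r ℚ.* s
  ⊏∞-* {x} {y} h k = ⊏-resp-≈ʳ {σ∞ x *ʳ σ∞ y} {σ∞ (x * y)}
    (≈ʳ-sym {σ∞ (x * y)} {σ∞ x *ʳ σ∞ y} (at∞.*-homo x y)) (⊏-* {σ∞ x} {σ∞ y} h k)

  ⊏∞-neg : ∀ {x r} → x ⊏∞ r → - x ⊏∞ r
  ⊏∞-neg {x} h = ⊏-resp-≈ʳ { -ʳ σ∞ x} {σ∞ (- x)} (≈ʳ-sym {σ∞ (- x)} { -ʳ σ∞ x} (at∞.-‿homo x))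
      (⊏-neg {σ∞ x} h)

  ⊏∞-bound : ∀ {z r} → ιᶻ z ⊏∞ r → ℤ.∣ z ∣ ≤ ℤ.∣ ℚ.↥ r ∣
  ⊏∞-bound {z} {r} h = fromInteger-bound {z} {r} (fromℚ-⊏ {fromInteger z}
    (⊏-resp-≈ʳ {σ∞ (ιᶻ z)} {fromℚ (fromInteger z)} (σ∞ι≈fromℚ (fromInteger z)) h))

  σ₂ιᶻ≈fromℤ₂ : ∀ z → σ₂ (ιᶻ z) ≈₂ fromℤ₂ z
  σ₂ιᶻ≈fromℤ₂ = ℤ-induction (λ z → σ₂ (ιᶻ z) ≈₂ fromℤ₂ z)
    (tr (ιᶻ (+ 0)) (fromℤ₂ (+ 0)) ι.0#-homo at₂.0#-homo)
    (λ z ih → tr (ιᶻ (+ 1 ℤ.+ z)) (fromℤ₂ (+ 1 ℤ.+ z)) (ιᶻ-+ (+ 1) z)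
      (≈₂-trans {σ₂ (ιᶻ (+ 1) + ιᶻ z)} {σ₂ (ιᶻ (+ 1)) +₂ σ₂ (ιᶻ z)} {fromℤ₂ (+ 1 ℤ.+ z)}
          (at₂.+-homo (ιᶻ (+ 1)) (ιᶻ z))
        (≈₂-trans {σ₂ (ιᶻ (+ 1)) +₂ σ₂ (ιᶻ z)} {fromℤ₂ (+ 1) +₂ fromℤ₂ z} {fromℤ₂ (+ 1 ℤ.+ z)}
          (+₂-cong {σ₂ (ιᶻ (+ 1))} {fromℤ₂ (+ 1)} {σ₂ (ιᶻ z)} {fromℤ₂ z}
            (tr (ιᶻ (+ 1)) (fromℤ₂ (+ 1)) ι.1#-homo at₂.1#-homo) ih)
          (λ n → ∣-respʳ (plus z) (ℤ∣.divides (+ 0) refl)))))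
    (λ z ih → tr (ιᶻ (ℤ.- z)) (fromℤ₂ (ℤ.- z)) (ιᶻ-neg z)
      (≈₂-trans {σ₂ (- ιᶻ z)} { -₂ σ₂ (ιᶻ z)} {fromℤ₂ (ℤ.- z)} (at₂.-‿homo (ιᶻ z))
        (-₂-cong {σ₂ (ιᶻ z)} {fromℤ₂ z} ih)))
    where
    open ℤ-Solver
    tr : ∀ x {y} u → x ≈ y → σ₂ y ≈₂ u → σ₂ x ≈₂ u
    tr x {y} u p q = ≈₂-trans {σ₂ x} {σ₂ y} {u} (at₂.⟦⟧-cong p) q
    plus : ∀ z → + 0 ≡ + 1 ℤ.* (+ 1 ℤ.* + 1 ℤ.+ + 1 ℤ.* z) ℤ.- + 1 ℤ.* (+ 1 ℤ.+ z)
    plus = solve 1 (λ z → con (+ 0) :=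
        con (+ 1) :* (con (+ 1) :* con (+ 1) :+ con (+ 1) :* z) :- con (+ 1) :* (con (+ 1) :+ z)) refl

  Integral : Carrier → Set
  Integral x = ValuationAtLeast 0 (σ₂ x)

  integral-resp : ∀ {x y} → x ≈ y → Integral x → Integral y
  integral-resp {x} {y} eq = valuation-resp 0 {σ₂ x} {σ₂ y} (at₂.⟦⟧-cong eq)

  integral-+ : ∀ {x y} → Integral x → Integral y → Integral (x + y)
  integral-+ {x} {y} h k = valuation-resp 0 {σ₂ x +₂ σ₂ y} {σ₂ (x + y)}
    (≈₂-sym {σ₂ (x + y)} {σ₂ x +₂ σ₂ y} (at₂.+-homo x y)) (valuation-+ 0 (σ₂ x) (σ₂ y) h k)

  integral-* : ∀ {x y} → Integral x → Integral y → Integral (x * y)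
  integral-* {x} {y} h k = valuation-resp 0 {σ₂ x *₂ σ₂ y} {σ₂ (x * y)}
    (≈₂-sym {σ₂ (x * y)} {σ₂ x *₂ σ₂ y} (at₂.*-homo x y)) (valuation-* 0 0 (σ₂ x) (σ₂ y) h k)

  integral-neg : ∀ {x} → Integral x → Integral (- x)
  integral-neg {x} h = valuation-resp 0 { -₂ σ₂ x} {σ₂ (- x)}
    (≈₂-sym {σ₂ (- x)} { -₂ σ₂ x} (at₂.-‿homo x)) (valuation-neg 0 (σ₂ x) h)

  valuation-ιᶻ : ∀ k z → 2^ k ∣ℤ z → ValuationAtLeast k (σ₂ (ιᶻ z))
  valuation-ιᶻ k z h = valuation-resp k {fromℤ₂ z} {σ₂ (ιᶻ z)}
    (≈₂-sym {σ₂ (ιᶻ z)} {fromℤ₂ z} (σ₂ιᶻ≈fromℤ₂ z)) (fromℤ₂-valuation k z h)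

  integral-ιᶻ : ∀ z → Integral (ιᶻ z)
  integral-ιᶻ z = valuation-ιᶻ 0 z (ℤ∣.divides z (sym (ℤ.*-identityʳ z)))

  -- This is the intersection of ℤ[1/2] with ℤ₂ being ℤ: if 2^k q = n and q is 2-adically integral,
  -- then n has valuation at least k, so 2^k divides n.
  integral-dyadic : ∀ {q} → Dyadic q → Integral (ι q) → ∃[ z ] (fromInteger z ≡ q)
  integral-dyadic {q} (k , n , eq) h = w , fromInteger-cancel (2 ℕ.^ k) {{ℕ.m^n≢0 2 k}}
    (trans (sym (fromInteger-* (2^ k) w))
      (trans (cong fromInteger (trans (ℤ.*-comm (2^ k) w) (sym (ℤ∣._∣_.equality divisible)))) (sym eq)))
    where
    product : ValuationAtLeast (k ℕ.+ 0) (σ₂ (ιᶻ (2^ k)) *₂ σ₂ (ι q))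
    product = valuation-* k 0 (σ₂ (ιᶻ (2^ k))) (σ₂ (ι q)) (valuation-ιᶻ k (2^ k) ℤ∣.∣-refl) h
    σ-eq : σ₂ (ιᶻ (2^ k)) *₂ σ₂ (ι q) ≈₂ fromℤ₂ n
    σ-eq = ≈₂-trans {σ₂ (ιᶻ (2^ k)) *₂ σ₂ (ι q)} {σ₂ (ιᶻ (2^ k) * ι q)} {fromℤ₂ n}
      (≈₂-sym {σ₂ (ιᶻ (2^ k) * ι q)} {σ₂ (ιᶻ (2^ k)) *₂ σ₂ (ι q)} (at₂.*-homo (ιᶻ (2^ k)) (ι q)))
      (≈₂-trans {σ₂ (ιᶻ (2^ k) * ι q)} {σ₂ (ιᶻ n)} {fromℤ₂ n}
        (at₂.⟦⟧-cong (K.trans (K.sym (ι.*-homo (fromInteger (2^ k)) q)) (ι-cong eq))) (σ₂ιᶻ≈fromℤ₂ n))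
    divisible : 2^ k ∣ℤ n
    divisible = valuation-fromℤ₂ k n (valuation-resp k {σ₂ (ιᶻ (2^ k)) *₂ σ₂ (ι q)} {fromℤ₂ n} σ-eq
      (subst (λ j → ValuationAtLeast j (σ₂ (ιᶻ (2^ k)) *₂ σ₂ (ι q))) (ℕ.+-identityʳ k) product))
    w : ℤ
    w = ℤ∣._∣_.quotient divisible

  -- The sharp values 1 and 1/2, half the respective step sizes, each enlarged by a quarter of
  -- itself.
  step-bound : Fin 2 → ℚ
  step-bound 0F = + 5 ℚ./ 4
  step-bound 1F = + 5 ℚ./ 8

  module Step (ε : Fin 2) {x y} (t : T K σ∞ σ₂ ε x y) where
    private
      β   = proj₁ t
      q   = proj₁ (proj₂ (proj₂ t))
      m   = proj₁ (proj₁ (proj₂ (proj₂ (proj₂ t))))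
      min = proj₁ (proj₁ (proj₂ (proj₁ (proj₂ (proj₂ (proj₂ t))))))
      k   = exp (σ₂ β)
      fl  = ⌊ σ₂ β ⌋₂

      xβ≈1 : x * β ≈ 1#
      xβ≈1 = proj₁ (proj₂ t)

      q≡ : q ≡ fromInteger (stepSize ε ℤ.* m) ℚ.+ fl
      q≡ = proj₂ (proj₂ (proj₁ (proj₂ (proj₂ (proj₂ t)))))

      y≈β-q : y ≈ β - ι q
      y≈β-q = proj₂ (proj₂ (proj₂ (proj₂ t)))

      x[y+q]≈1 : x * (y + ι q) ≈ 1#
      x[y+q]≈1 = K.trans (*-congˡ (K.trans (+-congʳ y≈β-q)
        (solve 2 (λ β q → β :- q :+ q := β) K.refl β (ι q)))) xβ≈1
        where open K-Solver

      z : ℤ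
      z = proj₁ (scaled-floor (σ₂ β))

      n : ℤ
      n = 2^ k ℤ.* (stepSize ε ℤ.* m) ℤ.+ z

      2ᵏq≡n : fromInteger (2^ k) ℚ.* q ≡ fromInteger n
      2ᵏq≡n = trans (cong (fromInteger (2^ k) ℚ.*_) q≡)
        (trans (ℚ.*-distribˡ-+ (fromInteger (2^ k)) (fromInteger (stepSize ε ℤ.* m)) fl)
          (trans (cong₂ ℚ._+_ (sym (fromInteger-* (2^ k) (stepSize ε ℤ.* m)))
              (proj₁ (proj₂ (scaled-floor (σ₂ β)))))
            (sym (fromInteger-+ (2^ k ℤ.* (stepSize ε ℤ.* m)) z))))

      dyadic : Dyadic q
      dyadic = k , n , 2ᵏq≡n

      -- Modulo 2^k the choice of m is invisible: it shifts the scaled partial quotient by a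
      -- multiple of 2^k. The real and 2-adic approximations therefore do not interfere.
      close : 2^ k ∣ℤ app (num (σ₂ β)) (k ℕ.+ k) ℤ.- n
      close = ∣-respʳ (lem (app (num (σ₂ β)) (k ℕ.+ k)) z (2^ k) (stepSize ε ℤ.* m))
        (ℤ∣.∣m∣n⇒∣m-n (proj₂ (proj₂ (scaled-floor (σ₂ β)))) (ℤ∣.∣m⇒∣m*n (stepSize ε ℤ.* m) ℤ∣.∣-refl))
        where
        open ℤ-Solver
        lem : ∀ a z P s → a ℤ.- z ℤ.- P ℤ.* s ≡ a ℤ.- (P ℤ.* s ℤ.+ z)
        lem = solve 4 (λ a z P s → a :- z :- P :* s := a :- (P :* s :+ z)) refl

    y-integral : Integral y
    y-integral = valuation-2^-* k (σ₂ y) (valuation-resp k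
      {fromℤ₂ (2^ k) *₂ σ₂ β +₂ fromℤ₂ (ℤ.- n)} {fromℤ₂ (2^ k) *₂ σ₂ y}
      (≈₂-sym {fromℤ₂ (2^ k) *₂ σ₂ y} {fromℤ₂ (2^ k) *₂ σ₂ β +₂ fromℤ₂ (ℤ.- n)} chain)
      (valuation-approximation (σ₂ β) n close))
      where
      P = ιᶻ (2^ k)
      Py : P * y ≈ P * β + ιᶻ (ℤ.- n)
      Py = begin
        P * y                      ≈⟨ *-congˡ y≈β-q ⟩
        P * (β - ι q)              ≈⟨ solve 3 (λ P β q → P :* (β :- q) := P :* β :- P :* q)
            K.refl P β (ι q) ⟩
        P * β - P * ι q            ≈⟨ +-congˡ
            (-‿cong (K.trans (K.sym (ι.*-homo (fromInteger (2^ k)) q)) (ι-cong 2ᵏq≡n))) ⟩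
        P * β - ιᶻ n               ≈⟨ +-congˡ (ιᶻ-neg n) ⟨
        P * β + ιᶻ (ℤ.- n)         ∎
        where open K-Solver
      scale : ∀ w → fromℤ₂ (2^ k) *₂ σ₂ w ≈₂ σ₂ (P * w)
      scale w = ≈₂-trans {fromℤ₂ (2^ k) *₂ σ₂ w} {σ₂ P *₂ σ₂ w} {σ₂ (P * w)}
        (*₂-cong {fromℤ₂ (2^ k)} {σ₂ P} {σ₂ w} {σ₂ w}
            (≈₂-sym {σ₂ P} {fromℤ₂ (2^ k)} (σ₂ιᶻ≈fromℤ₂ (2^ k)))
          (at₂.⟦⟧-cong {w} K.refl))
        (≈₂-sym {σ₂ (P * w)} {σ₂ P *₂ σ₂ w} (at₂.*-homo P w))
      chain : fromℤ₂ (2^ k) *₂ σ₂ y ≈₂ fromℤ₂ (2^ k) *₂ σ₂ β +₂ fromℤ₂ (ℤ.- n)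
      chain = ≈₂-trans {fromℤ₂ (2^ k) *₂ σ₂ y} {σ₂ (P * y)} {rhs} (scale y)
        (≈₂-trans {σ₂ (P * y)} {σ₂ (P * β + ιᶻ (ℤ.- n))} {rhs} (at₂.⟦⟧-cong Py)
          (≈₂-trans {σ₂ (P * β + ιᶻ (ℤ.- n))} {σ₂ (P * β) +₂ σ₂ (ιᶻ (ℤ.- n))} {rhs}
              (at₂.+-homo (P * β) (ιᶻ (ℤ.- n)))
            (+₂-cong {σ₂ (P * β)} {fromℤ₂ (2^ k) *₂ σ₂ β} {σ₂ (ιᶻ (ℤ.- n))} {fromℤ₂ (ℤ.- n)}
              (≈₂-sym {fromℤ₂ (2^ k) *₂ σ₂ β} {σ₂ (P * β)} (scale β)) (σ₂ιᶻ≈fromℤ₂ (ℤ.- n)))))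
        where rhs = fromℤ₂ (2^ k) *₂ σ₂ β +₂ fromℤ₂ (ℤ.- n)

    offset≈ : offset (σ∞ β) (stepSize ε) fl m ≈ʳ σ∞ y
    offset≈ = ≈ʳ-sym {σ∞ y} {offset (σ∞ β) (stepSize ε) fl m}
      (≈ʳ-trans {σ∞ y} {σ∞ (β - ι q)} {off} (at∞.⟦⟧-cong y≈β-q)
        (≈ʳ-trans {σ∞ (β - ι q)} {σ∞ β +ʳ σ∞ (- ι q)} {off} (at∞.+-homo β (- ι q))
          (≈ʳ-trans {σ∞ β +ʳ σ∞ (- ι q)} {σ∞ β -ʳ fromℚ q} {off}
            (+ʳ-cong {σ∞ β} {σ∞ β} {σ∞ (- ι q)} { -ʳ fromℚ q} (at∞.⟦⟧-cong {β} K.refl)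
              (≈ʳ-trans {σ∞ (- ι q)} { -ʳ σ∞ (ι q)} { -ʳ fromℚ q} (at∞.-‿homo (ι q))
                (-ʳ-cong {σ∞ (ι q)} {fromℚ q} (σ∞ι≈fromℚ q))))
            (≈ʳ-pointwise {σ∞ β -ʳ fromℚ q} {off} λ i →
              trans (cong (λ r → seq (σ∞ β) i ℚ.- r) q≡)
                  (lem (seq (σ∞ β) i) (fromInteger (stepSize ε ℤ.* m)) fl)))))
      where
      open ℚ-Solver
      off = offset (σ∞ β) (stepSize ε) fl m
      lem : ∀ x a f → x ℚ.- (a ℚ.+ f) ≡ x ℚ.- a ℚ.- f
      lem = solve 3 (λ x a f → x :- (a :+ f) := x :- a :- f) refl

    y-bound : y ⊏∞ step-bound ε
    y-bound = ⊏-resp-≈ʳ {offset (σ∞ β) (stepSize ε) fl m} {σ∞ y} offset≈ (go ε min)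
      where
      go : ∀ ε → IsMinimizer (λ i → ∣ offset (σ∞ β) (stepSize ε) fl i ∣ʳ) m →
           offset (σ∞ β) (stepSize ε) fl m ⊏ step-bound ε
      -- Here h is half the step and δ = h/16, so h + 3δ is 19/16 < 20/16 in this case and 19/32 <
      -- 20/32 in the next.
      go 0F = minimizer-⊏ (σ∞ β) (+ 2) fl m 1ℚ (+ 1 ℚ./ 16) (+ 5 ℚ./ 4) refl
        (toWitness {a? = _ ℚ.<? _} tt) (toWitness {a? = _ ℚ.<? _} tt) (toWitness {a? = _ ℚ.<? _} tt)
            (toWitness {a? = _ ℚ.<? _} tt)
      go 1F = minimizer-⊏ (σ∞ β) (+ 1) fl m ½ (+ 1 ℚ./ 32) (+ 5 ℚ./ 8) refl
        (toWitness {a? = _ ℚ.<? _} tt) (toWitness {a? = _ ℚ.<? _} tt) (toWitness {a? = _ ℚ.<? _} tt)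
            (toWitness {a? = _ ℚ.<? _} tt)

    irrational : ¬ IsRational x → ¬ IsRational y
    irrational irr y-rat = irr (rational-inverse xβ≈1 (rational-+ (rational-resp y≈β-q y-rat)))

    form : ∀ {d} (F : Form x d) → Integral x →
           ∃[ G ] (ιᶻ (a {y} { - d} G) ≈ ιᶻ (a F) * (x * x) - d * x)
    form {d} F x-integral = record
      { a = c F
      ; b = proj₁ b-integer
      ; c = proj₁ c-integer
      ; root = K.trans (+-cong (+-congˡ (*-congʳ (K.trans (ι-cong (proj₂ b-integer)) ι-b′)))
                               (K.trans (ι-cong (proj₂ c-integer)) ι-c′)) S.root′
      ; deriv = K.trans (+-congˡ (K.trans (ι-cong (proj₂ b-integer)) ι-b′)) S.derivative′
      } , S.leading
      where
      open K-Solver using (solve; _:=_; _:+_; _:*_; _:-_; :-_)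
      module S = Substitution {q = ι q} x[y+q]≈1 (root F) (deriv F)
      A = ιᶻ (a F)
      B = ιᶻ (b F)
      C = ιᶻ (c F)
      Q = ι q
      two# = ιᶻ (+ 2)

      b′ c′ : ℚ
      b′ = fromInteger (b F) ℚ.+ fromInteger (+ 2) ℚ.* q ℚ.* fromInteger (c F)
      c′ = fromInteger (a F) ℚ.+ q ℚ.* fromInteger (b F) ℚ.+ q ℚ.* q ℚ.* fromInteger (c F)

      ι-b′ : ι b′ ≈ B + two# * Q * C
      ι-b′ = K.trans (ι.+-homo _ _) (+-congˡ (K.trans (ι.*-homo _ _) (*-congʳ (ι.*-homo _ _))))

      ι-c′ : ι c′ ≈ A + Q * B + Q * Q * C
      ι-c′ = K.trans (ι.+-homo _ _) (+-cong (K.trans (ι.+-homo _ _) (+-congˡ (ι.*-homo _ _)))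
               (K.trans (ι.*-homo _ _) (*-congʳ (ι.*-homo _ _))))

      d-integral : Integral d
      d-integral = integral-resp (deriv F) (integral-+
        (integral-* (integral-* (integral-ιᶻ (+ 2)) (integral-ιᶻ (a F))) x-integral)
            (integral-ιᶻ (b F)))

      -- The defining formulas contain q, which may have powers of 2 in its denominator. Rewriting
      -- them as b′ = -d - 2cy and then c′ = -(cy² + b′y) leaves only integral quantities.
      b′-integral : Integral (ι b′)
      b′-integral = integral-resp {(- d) - two# * C * y} (begin
          (- d) - two# * C * y
            ≈⟨ +-congʳ S.derivative′ ⟨
          derivative C (B + two# * Q * C) y - two# * C * y
            ≈⟨ solve 2 (λ b u → u :+ b :- u := b) K.refl (B + two# * Q * C) (two# * C * y) ⟩
          B + two# * Q * C
            ≈⟨ ι-b′ ⟨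
          ι b′ ∎)
        (integral-+ (integral-neg d-integral)
          (integral-neg (integral-* (integral-* (integral-ιᶻ (+ 2)) (integral-ιᶻ (c F))) y-integral)))

      c′-integral : Integral (ι c′)
      c′-integral = integral-resp { - (C * (y * y) + ι b′ * y)} (begin
          - (C * (y * y) + ι b′ * y)
            ≈⟨ +-identityˡ _ ⟨
          0# - (C * (y * y) + ι b′ * y)
            ≈⟨ +-cong (K.sym S.root′) (-‿cong (+-congˡ (*-congʳ ι-b′))) ⟩
          quadratic C (B + two# * Q * C) (A + Q * B + Q * Q * C) y -
              (C * (y * y) + (B + two# * Q * C) * y)
            ≈⟨ solve 2 (λ c u → u :+ c :- u := c) K.refl (A + Q * B + Q * Q * C)
                (C * (y * y) + (B + two# * Q * C) * y) ⟩
          A + Q * B + Q * Q * C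
            ≈⟨ ι-c′ ⟨
          ι c′ ∎)
        (integral-neg (integral-+ (integral-* (integral-ιᶻ (c F)) (integral-* y-integral y-integral))
          (integral-* b′-integral y-integral)))

      b-integer = integral-dyadic (dyadic-b (b F) (c F) dyadic) b′-integral
      c-integer = integral-dyadic (dyadic-c (a F) (b F) (c F) dyadic) c′-integral

  -- Bounds on the coefficients along even indices, and repetition

  leading-bound : ∀ {x y d M S r} (F : Form x d) (G : Form y (- d)) →
    ιᶻ (a G) ≈ ιᶻ (a F) * (x * x) - d * x →
    ιᶻ (a F) ⊏∞ M → d ⊏∞ S → x ⊏∞ r → ιᶻ (a G) ⊏∞ M ℚ.* (r ℚ.* r) ℚ.+ S ℚ.* r
  leading-bound F G eq hA hd hx = ⊏∞-resp (K.sym eq) (⊏∞-+ (⊏∞-* hA (⊏∞-* hx hx)) (⊏∞-neg (⊏∞-* hd hx)))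

  -- The invariant at even indices. Each such element is the output of a step with ε = 1, which
  -- explains `step-bound 1F`. A bound on b is recovered from d, a and x and need not be carried
  -- along.
  record Reduced (d : Carrier) (M : ℚ) (x : Carrier) : Set ℓ where
    field
      form     : Form x d
      leading  : ιᶻ (a form) ⊏∞ M
      integral : Integral x
      small    : x ⊏∞ step-bound 1F

  -- Two steps are taken together because they restore the sign of d, and because one step from an
  -- element bounded only by 5/4 could enlarge M; the inequality required of M is the one that
  -- `contraction` supplies.
  reduced-two-steps : ∀ {d M S x y z} → d ⊏∞ S →
    (M ℚ.* (step-bound 1F ℚ.* step-bound 1F) ℚ.+ S ℚ.* step-bound 1F) ℚ.*
        (step-bound 0F ℚ.* step-bound 0F)
      ℚ.+ S ℚ.* step-bound 0F ℚ.≤ M →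
    T K σ∞ σ₂ 0F x y → T K σ∞ σ₂ 1F y z → Reduced d M x → Reduced d M z
  reduced-two-steps {d} {M} {S} {x} {y} {z} hd ≤M t u R = record
    { form     = H
    ; leading  = ⊏-≤-trans {σ∞ (ιᶻ (a H))} (leading-bound (proj₁ G) (proj₁ H′) (proj₂ H′)
                   (leading-bound (Reduced.form R) (proj₁ G) (proj₂ G) (Reduced.leading R) hd
                       (Reduced.small R))
                   (⊏∞-neg hd) (Step.y-bound 0F t)) ≤M
    ; integral = Step.y-integral 1F u
    ; small    = Step.y-bound 1F u
    }
    where
    G = Step.form 0F t (Reduced.form R) (Reduced.integral R)
    H′ = Step.form 1F u (proj₁ G) (Step.y-integral 0F t)
    H : Form z d
    H = record { a = a (proj₁ H′) ; b = b (proj₁ H′) ; c = c (proj₁ H′) ; root = root (proj₁ H′)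
               ; deriv = K.trans (deriv (proj₁ H′)) (-‿involutive d) }

  private
    two-bounded = bounded (σ∞ (ιᶻ (+ 2)))

  linear-bound : ∀ {d M S x} → d ⊏∞ S → (r : Reduced d M x) →
                 ιᶻ (b (Reduced.form r)) ⊏∞ S ℚ.+ proj₁ two-bounded ℚ.* M ℚ.* step-bound 1F
  linear-bound {d} {x = x} hd r = ⊏∞-resp (begin
      d - u            ≈⟨ +-congʳ (deriv form) ⟨
      u + B - u        ≈⟨ solve 2 (λ u b → u :+ b :- u := b) K.refl u B ⟩
      B                ∎)
    (⊏∞-+ hd (⊏∞-neg (⊏∞-* (⊏∞-* (proj₂ two-bounded) leading) small)))
    where
    open K-Solver using (solve; _:=_; _:+_; _:-_)
    open Reduced r
    B = ιᶻ (b form)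
    u = ιᶻ (+ 2) * ιᶻ (a form) * x

  reduced-repeats : ∀ {d M S} → ¬ IsRational d → d ⊏∞ S → (s : ℕ → Carrier) →
                    (∀ j → Reduced d M (s j)) → ∃₂ λ i j → i < j × s i ≈ s j
  reduced-repeats {d} {M} {S} irr hd s r =
    let i , j , i<j , a≡ , b≡ = bounded-pairs-repeat L N (λ j → a (form j)) (λ j → b (form j)) boundᵃ boundᵇ
    in i , j , i<j , form-determines (form i) (form j) irr a≡ b≡
    where
    form : ∀ j → Form (s j) d
    form j = Reduced.form (r j)
    L N : ℕ
    L = ℤ.∣ ℚ.↥ M ∣
    N = ℤ.∣ ℚ.↥ (S ℚ.+ proj₁ two-bounded ℚ.* M ℚ.* step-bound 1F) ∣
    boundᵃ : ∀ j → ℤ.∣ a (form j) ∣ ≤ L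
    boundᵃ j = ⊏∞-bound {a (form j)} {M} (Reduced.leading (r j))
    boundᵇ : ∀ j → ℤ.∣ b (form j) ∣ ≤ N
    boundᵇ j = ⊏∞-bound {b (form j)} (linear-bound hd (r j))

-- Two steps turn a bound M for |a| into (M r² + S r) s² + S s, where S bounds |d| and
-- r = 5/8, s = 5/4 bound |x| in turn; this is a contraction since r s < 1.
contraction : ∀ R S → 0ℚ ℚ.≤ R → 0ℚ ℚ.≤ S →
  ((R ℚ.+ (+ 8 ℚ./ 1) ℚ.* S) ℚ.* ((+ 5 ℚ./ 8) ℚ.* (+ 5 ℚ./ 8)) ℚ.+ S ℚ.* (+ 5 ℚ./ 8)) ℚ.*
      ((+ 5 ℚ./ 4) ℚ.* (+ 5 ℚ./ 4))
    ℚ.+ S ℚ.* (+ 5 ℚ./ 4) ℚ.≤ R ℚ.+ (+ 8 ℚ./ 1) ℚ.* S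
contraction R S 0≤R 0≤S = subst₂ ℚ._≤_ (ℚ.+-identityʳ _) (lem R S) (ℚ.+-monoʳ-≤ expr
  -- With r = 5/8 and s = 5/4, the slack in R is 1 - r²s² = 399/1024 and the slack in S is 8 -
  -- (8r²s² + rs² + s) = 57/64. Any multiple of S from (rs² + s)/(1 - r²s²) = 40/7 upwards would do;
  -- 8 is a convenient one.
  (ℚ.+-mono-≤ {0ℚ} {(+ 399 ℚ./ 1024) ℚ.* R} {0ℚ} {(+ 57 ℚ./ 64) ℚ.* S}
    (subst (ℚ._≤ (+ 399 ℚ./ 1024) ℚ.* R) (ℚ.*-zeroʳ (+ 399 ℚ./ 1024))
        (ℚ.*-monoˡ-≤-nonNeg (+ 399 ℚ./ 1024) 0≤R))
    (subst (ℚ._≤ (+ 57 ℚ./ 64) ℚ.* S) (ℚ.*-zeroʳ (+ 57 ℚ./ 64))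
        (ℚ.*-monoˡ-≤-nonNeg (+ 57 ℚ./ 64) 0≤S))))
  where
  open ℚ-Solver
  expr : ℚ
  expr = ((R ℚ.+ (+ 8 ℚ./ 1) ℚ.* S) ℚ.* ((+ 5 ℚ./ 8) ℚ.* (+ 5 ℚ./ 8)) ℚ.+ S ℚ.* (+ 5 ℚ./ 8)) ℚ.*
      ((+ 5 ℚ./ 4) ℚ.* (+ 5 ℚ./ 4))
    ℚ.+ S ℚ.* (+ 5 ℚ./ 4)
  lem : ∀ R S → ((R ℚ.+ (+ 8 ℚ./ 1) ℚ.* S) ℚ.* ((+ 5 ℚ./ 8) ℚ.* (+ 5 ℚ./ 8)) ℚ.+ S ℚ.*
      (+ 5 ℚ./ 8)) ℚ.* ((+ 5 ℚ./ 4) ℚ.* (+ 5 ℚ./ 4))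
    ℚ.+ S ℚ.* (+ 5 ℚ./ 4) ℚ.+ ((+ 399 ℚ./ 1024) ℚ.* R ℚ.+ (+ 57 ℚ./ 64) ℚ.* S) ≡ R ℚ.+ (+ 8 ℚ./ 1) ℚ.* S
  lem = solve 2 (λ R S → ((R :+ con (+ 8 ℚ./ 1) :* S) :*
      (con (+ 5 ℚ./ 8) :* con (+ 5 ℚ./ 8)) :+ S :* con (+ 5 ℚ./ 8)) :*
          (con (+ 5 ℚ./ 4) :* con (+ 5 ℚ./ 4))
    :+ S :* con (+ 5 ℚ./ 4) :+ (con (+ 399 ℚ./ 1024) :* R :+ con (+ 57 ℚ./ 64) :* S) :=
        R :+ con (+ 8 ℚ./ 1) :* S) refl

-- The orbit at even indices

¬2∣odd : ∀ n → 2 ℕ∣.∣ n → ¬ (2 ℕ∣.∣ suc n)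
¬2∣odd n 2∣n 2∣1+n with ℕ∣.∣1⇒≡1 (ℕ∣.∣m+n∣m⇒∣n (subst (2 ℕ∣.∣_) (ℕ.+-comm 1 n) 2∣1+n) 2∣n)
... | ()

theorem3p19 : ∀ {c ℓ} (K : QuadraticField c ℓ) →
    let open QuadraticField K in
    (σ∞ : Carrier → ℝ) → IsRingMonomorphism rawRing ℝ-rawRing σ∞ →
    (σ₂ : Carrier → ℚ₂) → IsRingMonomorphism rawRing ℚ₂-rawRing σ₂ →
    (α : Carrier) → ¬ IsRational α → PropertyI K σ∞ σ₂ α →
    (s : ℕ → Carrier) → GeneratedFrom K σ∞ σ₂ α s →
    ∃₂ λ n₁ n₂ → 1 ≤ n₁ × n₁ < n₂ × s n₁ ≈ s n₂ × n₁ % 2 ≡ n₂ % 2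
theorem3p19 K σ∞ σ∞-mono σ₂ σ₂-mono α α-irr _ s gen =
  let i , j , i<j , eq = reduced-repeats {d} {M} {S} d-irr (proj₂ d-bounded) (λ j → s (index j)) reduced
  in index i , index j , ℕ.s≤s ℕ.z≤n , index-mono i j i<j , eq ,
     trans (index-even i) (sym (index-even j))
  where
  open QuadraticField K hiding (zero; refl; sym; trans)
  module K = QuadraticField K
  open Field K
  open Embedded K σ∞ σ∞-mono σ₂ σ₂-mono
  open GeneratedFrom gen using (even; odd)
  open Reduced

  index : ℕ → ℕ
  -- Even positions hold the outputs of steps with ε = 1, and position 2 is the first of them: its
  -- integrality and its size come from the step that produced it.
  index j = 2 ℕ.+ j ℕ.* 2

  index-mono : ∀ i j → i < j → index i < index j
  index-mono i j i<j = ℕ.+-monoʳ-< 2 (ℕ.*-monoˡ-< 2 i<j)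

  index-even : ∀ j → index j % 2 ≡ 0
  index-even j = ℕ.m*n%n≡0 (suc j) 2

  2∣index : ∀ j → 2 ℕ∣.∣ index j
  2∣index j = ℕ∣.divides (suc j) refl

  first : T K σ∞ σ₂ 1F (s 1) (s 2)
  first = odd 1 ℕ.≤-refl (¬2∣odd 0 (2 ℕ∣.∣0))

  x-irr : ¬ IsRational (s 2)
  x-irr = Step.irrational 1F first (λ rat → α-irr (rational-resp (GeneratedFrom.start gen) rat))

  minimal = minimal-form (s 2) x-irr
  d  = proj₁ minimal
  F₀ = proj₁ (proj₂ minimal)

  d-irr : ¬ IsRational d
  d-irr = deriv-irrational F₀ x-irr (proj₂ (proj₂ minimal))

  A-bounded = bounded (σ∞ (ιᶻ (a F₀)))
  d-bounded = bounded (σ∞ d)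
  R = proj₁ A-bounded
  S = proj₁ d-bounded
  M = R ℚ.+ (+ 8 ℚ./ 1) ℚ.* S

  0≤S : 0ℚ ℚ.≤ S
  0≤S = ⊏⇒nonNegative {σ∞ d} (proj₂ d-bounded)

  R≤M : R ℚ.≤ M
  R≤M = subst (ℚ._≤ M) (ℚ.+-identityʳ R) (ℚ.+-monoʳ-≤ R
    (subst (ℚ._≤ (+ 8 ℚ./ 1) ℚ.* S) (ℚ.*-zeroʳ (+ 8 ℚ./ 1)) (ℚ.*-monoˡ-≤-nonNeg (+ 8 ℚ./ 1) 0≤S)))

  reduced : ∀ j → Reduced d M (s (index j))
  reduced zero = record
    { form     = F₀
    ; leading  = ⊏-≤-trans {σ∞ (ιᶻ (a F₀))} (proj₂ A-bounded) R≤M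
    ; integral = Step.y-integral 1F first
    ; small    = Step.y-bound 1F first
    }
  reduced (suc j) = reduced-two-steps (proj₂ d-bounded)
    (contraction R S (⊏⇒nonNegative {σ∞ (ιᶻ (a F₀))} (proj₂ A-bounded)) 0≤S)
    (even (index j) (ℕ.s≤s ℕ.z≤n) (2∣index j))
    (odd (suc (index j)) (ℕ.s≤s ℕ.z≤n) (¬2∣odd (index j) (2∣index j)))
    (reduced j)
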